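{- Let $X=\mathcal{V}(\varphi)_+$ for some piecewise-linear function $\varphi:\mathbb{R}^2\to\mathbb{R}$. Let $\mathcal{V}_1+\cdots+\mathcal{V}_n$ be a minimal balancing of $X$ with respect to factorization complexity. Then $$\mathrm{fComp}(\mathcal{A}_X)\le 3\,\mathrm{fComp}(\mathcal{V}_1+\cdots+\mathcal{V}_n),$$ where $\mathcal{A}_X$ is the associated arrangement of $X$, given as the sum of all its hyperplanes.
   Context: A tropical polynomial on $\mathbb{R}^d$ is a function $g(x)=\max_{1\le i\le n}(\langle b_i,x\rangle+a_i)$, $a_i\in\mathbb{R}$, $b_i\in\mathbb{R}^d$; piecewise-linear functions (continuous, finitely many affine pieces) are the differences of two tropical polynomials. $\mathcal{V}(\varphi)=\{x:\varphi\text{ is not affine in any neighbourhood of }x\}$ is a pure $(d-1)$-dimensional polyhedral complex, weighted by $w_\varphi(\sigma)=\pm\|u_1-u_2\|$ on a $(d-1)$-face $\sigma$ separating regions with gradients $u_1,u_2$, with sign $+$ if $\varphi$ is locally convex along $\sigma$ and $-$ if locally concave. $\mathcal{V}(\varphi)_+$ is the subcomplex of positive-weight faces, i.e. the closure of the set of points near which $\varphi$ is convex and not affine, with weight $|w_\varphi|$. Polyhedral structures are considered up to refinement. A tropical hypersurface is $\mathcal{V}(g)$ (with its weights) for a tropical polynomial $g$. The sum of weighted complexes is their union with weights added where $(d-1)$-dimensional parts overlap; $\mathcal{V}(g+h)=\mathcal{V}(g)+\mathcal{V}(h)$. A tropical hypersurface $Z$ with weight $w_Z$ is a balancing of $X=\mathcal{V}(\varphi)_+$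 if $X$ is a subcomplex of $Z$ and $w_Z(\sigma)\ge w_\varphi(\sigma)$ for every $(d-1)$-face $\sigma$ of $X$. For a tropical hypersurface $Z$, $\mathrm{mComp}(Z)$ is the number of connected components of $\mathbb{R}^d\setminus Z$. For a tropical hypersurface given as a sum of tropical hypersurfaces, $\mathrm{fComp}(\mathcal{V}_1+\cdots+\mathcal{V}_n)=\sum_{i=1}^n\mathrm{mComp}(\mathcal{V}_i)-(n-1)$ (it depends on the decomposition). A minimal balancing of $X$ with respect to factorization complexity is a balancing $\mathcal{V}_1+\cdots+\mathcal{V}_n$ of $X$, given as a sum of tropical hypersurfaces $\mathcal{V}_i$, whose $\mathrm{fComp}$ is smallest among all balancings of $X$ given as sums of tropical hypersurfaces. The associated arrangement $\mathcal{A}_X$ is the collection of all affine hyperplanes (lines when $d=2$) spanned by the $(d-1)$-faces of $X$, with weights inherited from the faces; it is a balancing of $X$. If it has $N$ distinct hyperplanes, then, given as the sum of these hyperplanes, $\mathrm{fComp}(\mathcal{A}_X)=2N-(N-1)=N+1$. -}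

module Defs where

open import Level using (0ℓ)
open import Algebra.Structures using (IsCommutativeRing)
import Algebra.Construct.NaturalChoice.Max as Max
open import Data.Empty using (⊥)
open import Data.Fin.Base using (Fin)
open import Data.Integer.Base as ℤ using (ℤ; 1ℤ)
open import Data.List.Base as List using (List; foldr; length)
open import Data.List.NonEmpty.Base as List⁺ using (List⁺)
open import Data.List.Relation.Binary.Pointwise using (Pointwise)
open import Data.List.Relation.Unary.All using (All)
open import Data.List.Relation.Unary.AllPairs using (AllPairs)
open import Data.List.Relation.Unary.Any using (Any)
open import Data.Nat.Base using (ℕ)
open import Data.Nat.ListAction using (sum)
open import Data.Product.Base using (∃; ∃₂; _×_; _,_; proj₁; proj₂)
open import Relation.Binary.Bundles using (TotalOrder)
open import Relation.Binary.Core using (Rel)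
open import Relation.Binary.PropositionalEquality.Core using (_≡_; _≢_)
import Relation.Binary.Construct.NonStrictToStrict as ToStrict
open import Relation.Binary.Structures using (IsTotalOrder)
open import Relation.Nullary.Negation.Core using (¬_)
open import Relation.Unary using (Pred; Satisfiable; ∁; _⊆_; _∪_; _∩_; _≐_)

-- The real numbers, axiomatised up to isomorphism.
record CompleteOrderedField : Set₁ where
  infix  8 -_
  infixl 7 _*_
  infixl 6 _+_ _-_
  infix  4 _≤_ _<_

  field
    ℝ                 : Set
    _+_ _*_           : ℝ → ℝ → ℝ
    -_                : ℝ → ℝ
    0# 1#             : ℝ
    isCommutativeRing : IsCommutativeRing _≡_ _+_ _*_ -_ 0# 1#
    0≢1               : 0# ≢ 1#
    inverse           : ∀ x → x ≢ 0# → ∃ λ y → x * y ≡ 1#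
    _≤_               : Rel ℝ 0ℓ
    isTotalOrder      : IsTotalOrder _≡_ _≤_
    +-monoˡ-≤         : ∀ z {x y} → x ≤ y → x + z ≤ y + z
    *-nonNeg          : ∀ {x y} → 0# ≤ x → 0# ≤ y → 0# ≤ x * y

  UpperBound : Pred ℝ 0ℓ → Pred ℝ 0ℓ
  UpperBound P b = ∀ x → P x → x ≤ b

  field
    supremum : (P : Pred ℝ 0ℓ) → Satisfiable P → Satisfiable (UpperBound P) →
               ∃ λ s → UpperBound P s × (∀ b → UpperBound P b → s ≤ b)

  _-_ : ℝ → ℝ → ℝ
  x - y = x + (- y)

  _<_ : Rel ℝ 0ℓ
  _<_ = ToStrict._<_ _≡_ _≤_

  totalOrder : TotalOrder 0ℓ 0ℓ 0ℓ
  totalOrder = record { isTotalOrder = isTotalOrder }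

  open Max totalOrder public using (_⊔_)

module TropicalPlane (R : CompleteOrderedField) where
  open CompleteOrderedField R

  infixl 6 _+ᵖ_ _-ᵖ_
  infixr 7 _·_

  Point : Set
  Point = ℝ × ℝ

  0ᵖ : Point
  0ᵖ = 0# , 0#

  _+ᵖ_ _-ᵖ_ : Point → Point → Point
  (x₁ , x₂) +ᵖ (y₁ , y₂) = x₁ + y₁ , x₂ + y₂
  (x₁ , x₂) -ᵖ (y₁ , y₂) = x₁ - y₁ , x₂ - y₂

  _·_ : ℝ → Point → Point
  t · (x₁ , x₂) = t * x₁ , t * x₂

  ⟨_,_⟩ : Point → Point → ℝ
  ⟨ (x₁ , x₂) , (y₁ , y₂) ⟩ = x₁ * y₁ + x₂ * y₂

  IsNorm : Point → ℝ → Set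
  IsNorm u r = 0# ≤ r × r * r ≡ ⟨ u , u ⟩

  -- The open Euclidean disc, for ε > 0.
  Ball : Point → ℝ → Pred Point 0ℓ
  Ball x ε y = ⟨ y -ᵖ x , y -ᵖ x ⟩ < ε * ε

  Near : Point → (Pred Point 0ℓ → Set) → Set
  Near x P = ∃ λ ε → 0# < ε × P (Ball x ε)

  Open : Pred Point 0ℓ → Set
  Open U = ∀ x → U x → Near x (_⊆ U)

  Closure : Pred Point 0ℓ → Pred Point 0ℓ
  Closure S x = ∀ ε → 0# < ε → Satisfiable (S ∩ Ball x ε)

  Connected : Pred Point 0ℓ → Set₁
  Connected S = (U V : Pred Point 0ℓ) → Open U → Open V → S ⊆ U ∪ V →
                Satisfiable (S ∩ U) → Satisfiable (S ∩ V) → Satisfiable (S ∩ (U ∩ V))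

  SameComponent : Pred Point 0ℓ → Point → Point → Set₁
  SameComponent A x y = ∃ λ S → S ⊆ A × Connected S × S x × S y

  -- A has exactly m connected components: Fin m indexes a system of
  -- representatives.
  record NumberOfComponents (A : Pred Point 0ℓ) (m : ℕ) : Set₁ where
    field
      representative   : Fin m → Point
      representative∈A : ∀ i → A (representative i)
      covers           : ∀ x → A x → ∃ λ i → SameComponent A x (representative i)
      distinct         : ∀ i j → SameComponent A (representative i) (representative j) → i ≡ j

  record Affine : Set where
    constructor affine
    field
      gradient : Point
      const    : ℝ

    eval : Point → ℝ
    eval x = ⟨ gradient , x ⟩ + const

  open Affine public

  TropicalPolynomial : Set
  TropicalPolynomial = List⁺ Affine

  ⟦_⟧ : TropicalPolynomial → Point → ℝ
  ⟦ g ⟧ x = List⁺.foldr₁ _⊔_ (List⁺.map (λ ℓ → eval ℓ x) g)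

  Continuous : (Point → ℝ) → Set
  Continuous φ = ∀ x ε → 0# < ε →
    Near x λ B → ∀ y → B y → φ y - φ x < ε × φ x - φ y < ε

  record Piece : Set where
    field
      inequalities : List Affine
      value        : Affine

    Region : Pred Point 0ℓ
    Region x = All (λ ℓ → eval ℓ x ≤ 0#) inequalities

  record PiecewiseLinear (φ : Point → ℝ) : Set where
    field
      continuous : Continuous φ
      pieces     : List Piece
      cover      : ∀ x → Any (λ P → Piece.Region P x) pieces
      agrees     : All (λ P → ∀ x → Piece.Region P x → φ x ≡ eval (Piece.value P) x) pieces

  AffineOn ConvexOn ConcaveOn : (Point → ℝ) → Pred Point 0ℓ → Set
  AffineOn φ S = ∃ λ ℓ → ∀ y → S y → φ y ≡ eval ℓ y
  ConvexOn φ S = ∀ y z t → S y → S z → 0# ≤ t → t ≤ 1# →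
    φ ((1# - t) · y +ᵖ t · z) ≤ (1# - t) * φ y + t * φ z
  ConcaveOn φ = ConvexOn (λ x → - φ x)

  record Segment : Set where
    field
      p q : Point
      p≢q : p ≢ q

    at : ℝ → Point
    at t = p +ᵖ t · (q -ᵖ p)

    RelInt AffineHull : Pred Point 0ℓ
    RelInt x     = ∃ λ t → 0# < t × t < 1# × x ≡ at t
    AffineHull x = ∃ λ t → x ≡ at t

    -- Twice the signed area of the triangle p q y; its sign tells the two
    -- sides of AffineHull apart.
    side : Point → ℝ
    side y = (proj₁ q - proj₁ p) * (proj₂ y - proj₂ p)
           - (proj₂ q - proj₂ p) * (proj₁ y - proj₁ p)

  open Segment public using (RelInt; AffineHull; side)

  -- A weighted 1-dimensional polyhedral complex up to refinement.  Its faces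
  -- are represented by the nondegenerate segments that are 1-dimensional faces
  -- of some refinement; an unbounded face is the union of such segments.
  -- HasWeight σ w says that σ is such a face and has weight w.
  record WeightedComplex : Set₁ where
    field
      Support   : Pred Point 0ℓ
      HasWeight : Segment → ℝ → Set

  open WeightedComplex public

  -- σ separates two regions on which φ has the distinct gradients u₁ and u₂.
  record Separates (φ : Point → ℝ) (σ : Segment) (u₁ u₂ : Point) : Set where
    field
      c₁ c₂     : ℝ
      u₁≢u₂     : u₁ ≢ u₂
      two-sided : ∀ x → RelInt σ x → Near x λ B → ∀ y → B y →
                    (0# ≤ side σ y → φ y ≡ eval (affine u₁ c₁) y) ×
                    (side σ y ≤ 0# → φ y ≡ eval (affine u₂ c₂) y)

  data FaceWeight (φ : Point → ℝ) (σ : Segment) : ℝ → Set where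
    convex  : ∀ {u₁ u₂ w} → Separates φ σ u₁ u₂ → IsNorm (u₁ -ᵖ u₂) w →
              (∀ x → RelInt σ x → Near x (ConvexOn φ)) → FaceWeight φ σ w
    concave : ∀ {u₁ u₂ w} → Separates φ σ u₁ u₂ → IsNorm (u₁ -ᵖ u₂) w →
              (∀ x → RelInt σ x → Near x (ConcaveOn φ)) → FaceWeight φ σ (- w)

  𝒱 : (Point → ℝ) → WeightedComplex
  𝒱 φ = record
    { Support   = λ x → ¬ Near x (AffineOn φ)
    ; HasWeight = FaceWeight φ
    }

  𝒱₊ : (Point → ℝ) → WeightedComplex
  𝒱₊ φ = record
    { Support   = Closure λ x → Near x (ConvexOn φ) × ¬ Near x (AffineOn φ)
    ; HasWeight = λ σ w → HasWeight (𝒱 φ) σ w × 0# < w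
    }

  hypersurface : TropicalPolynomial → WeightedComplex
  hypersurface g = 𝒱 ⟦ g ⟧

  -- Faces of the common refinement: either a face of both summands, or a face
  -- of one whose relative interior misses the other.
  data SumWeight (C D : WeightedComplex) (σ : Segment) : ℝ → Set where
    both  : ∀ {v w} → HasWeight C σ v → HasWeight D σ w → SumWeight C D σ (v + w)
    left  : ∀ {w} → HasWeight C σ w → RelInt σ ⊆ ∁ (Support D) → SumWeight C D σ w
    right : ∀ {w} → RelInt σ ⊆ ∁ (Support C) → HasWeight D σ w → SumWeight C D σ w

  infixr 6 _⊕_

  _⊕_ : WeightedComplex → WeightedComplex → WeightedComplex
  C ⊕ D = record
    { Support   = Support C ∪ Support D
    ; HasWeight = SumWeight C D
    }

  ∅ᶜ : WeightedComplex
  ∅ᶜ = record { Support = λ _ → ⊥ ; HasWeight = λ _ _ → ⊥ }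

  ⨁ : List WeightedComplex → WeightedComplex
  ⨁ = foldr _⊕_ ∅ᶜ

  -- The balancing condition on Z.  It is only applied to sums of tropical
  -- hypersurfaces, which are tropical hypersurfaces because
  -- 𝒱 (g + h) = 𝒱 g ⊕ 𝒱 h.
  record Balances (X Z : WeightedComplex) : Set where
    field
      subcomplex : Support X ⊆ Support Z
      weights    : ∀ σ {v w} → HasWeight X σ v → HasWeight Z σ w → v ≤ w

  MComp : WeightedComplex → ℕ → Set₁
  MComp Z = NumberOfComponents (∁ (Support Z))

  FComp : List WeightedComplex → ℤ → Set₁
  FComp Vs c = ∃ λ ms → Pointwise MComp Vs ms ×
    c ≡ (ℤ.+ sum ms) ℤ.- ((ℤ.+ length Vs) ℤ.- 1ℤ)

  record IsMinimalBalancing (X : WeightedComplex) (gs : List TropicalPolynomial) (c : ℤ) : Set₁ where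
    field
      balances : Balances X (⨁ (List.map hypersurface gs))
      fComp    : FComp (List.map hypersurface gs) c
      minimal  : ∀ hs d → Balances X (⨁ (List.map hypersurface hs)) →
                 FComp (List.map hypersurface hs) d → c ℤ.≤ d

  record WeightedLine : Set where
    field
      equation   : Affine
      gradient≢0 : gradient equation ≢ 0ᵖ
      weight     : ℝ

    Line : Pred Point 0ℓ
    Line x = eval equation x ≡ 0#

  open WeightedLine public using (Line; weight)

  SpannedBy : WeightedLine → Segment → Set
  SpannedBy L σ = Line L ≐ AffineHull σ

  lineComplex : WeightedLine → WeightedComplex
  lineComplex L = record
    { Support   = Line L
    ; HasWeight = λ σ w → SpannedBy L σ × w ≡ weight L
    }

  -- Different faces of X may span the same line; the line then inherits the
  -- largest of their weights.
  record IsAssociatedArrangement (X : WeightedComplex) (Ls : List WeightedLine) : Set where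
    field
      spanned  : All (λ L → ∃ λ σ → HasWeight X σ (weight L) × SpannedBy L σ) Ls
      largest  : All (λ L → ∀ σ {w} → HasWeight X σ w → SpannedBy L σ → w ≤ weight L) Ls
      complete : ∀ σ {w} → HasWeight X σ w → Any (λ L → SpannedBy L σ) Ls
      distinct : AllPairs (λ L M → ¬ (Line L ≐ Line M)) Ls

{-# OPTIONS --safe #-}
module Submission where

-- Choose a generic direction as vertical and order the regions of a tropical
-- polynomial by their slope in it.  Charge an edge between a below and b above
-- according to what happens at its left end: if the edge has no left end or the
-- region b starts there, to b as upper region; if a starts there, to a as lower
-- region; otherwise some region c lying between a and b ends there, and the edge
-- is charged to c.  Each region receives at most one edge in each of these three
-- ways, and the lowest and highest regions leave three charges unused, so the
-- edges of a curve with m regions lie on at most 3 (m - 1) lines.  Every line of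
-- the arrangement contains an edge of some summand of the balancing, and its
-- complement has at most two components; summing up gives the bound.
open import Defs
open import Level using (0ℓ)
open import Algebra.Bundles using (CommutativeRing; RawRing)
import Algebra.Construct.NaturalChoice.Max as Max
import Algebra.Properties.Ring
import Algebra.Properties.Semiring.Mult.TCOptimised
import Algebra.Solver.Ring
open import Algebra.Solver.Ring.AlmostCommutativeRing using (fromCommutativeRing; _-Raw-AlmostCommutative⟶_)
open import Axiom.ExcludedMiddle using (ExcludedMiddle)
open import Data.Empty using (⊥)
open import Data.Fin.Base as Fin using (Fin; zero; suc; toℕ; combine; punchOut)
import Data.Fin.Properties as Fin
open import Data.Integer.Base as ℤ using (ℤ; +_; -[1+_]; _⊖_)
import Data.Integer.Properties as ℤ
import Data.Integer.Solver as ℤ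
open import Data.List.Base as List using (List; []; _∷_; map; length; filter; cartesianProduct; concatMap)
open import Data.List.Membership.Propositional using (_∈_; lose)
open import Data.List.Membership.Propositional.Properties using (∈-lookup; ∈-map⁺; ∈-cartesianProduct⁺; ∈-concatMap⁺)
open import Data.List.NonEmpty.Base using (_∷_; toList)
open import Data.List.Properties using (length-map)
open import Data.List.Relation.Binary.Pointwise using (Pointwise; []; _∷_)
open import Data.List.Relation.Unary.All as All using (All; []; _∷_)
import Data.List.Relation.Unary.All.Properties as All
open import Data.List.Relation.Unary.AllPairs using (AllPairs; []; _∷_)
import Data.List.Relation.Unary.AllPairs.Properties as AllPairs
open import Data.List.Relation.Unary.Any as Any using (Any; here; there)
import Data.List.Relation.Unary.Any.Properties as Any
import Data.Maybe.Base as Maybe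
open import Data.Nat.Base as ℕ using (ℕ; zero; suc)
open import Data.Nat.ListAction using (sum)
import Data.Nat.Properties as ℕ
import Data.Nat.Solver as ℕ
open import Data.Product.Base using (∃; ∃₂; _×_; _,_; proj₁; proj₂)
open import Data.Sum.Base using (_⊎_; inj₁; inj₂)
open import Relation.Binary.Consequences using (dec⇒weaklyDec)
import Relation.Binary.Construct.NonStrictToStrict
open import Relation.Binary.Core using (Rel)
open import Relation.Binary.PropositionalEquality
open import Relation.Binary.Structures using (IsTotalOrder)
open import Relation.Nullary using (¬_; Dec; yes; no; contradiction; decidable-stable)
open import Relation.Unary using (Pred; Decidable; Satisfiable; _⊆_; _∩_; _∪_; ∁; _≐_)
open import Relation.Unary.Properties using (∁?)

-- Edges of a planar subdivision are usually counted by Euler's formula; here planarity enters only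
-- through comparisons on vertical lines. On such a line the polynomial is a convex function of the
-- height, so the regions met appear in order of slope, and different edges met by one line have
-- slope intervals without common interior. Two edges charged to one region in the same way do have
-- overlapping intervals, so it remains to find a vertical line that meets both; the charges are
-- recorded with exactly the data that produce it. The three cases are exhaustive because at a left
-- end a third region `c` ties with `a` and `b`, and among three terms that tie the one with the
-- middle slope is hidden on one side: `a` or `b` on the left, or `c` on the right. With N lines and
-- n summands having M regions in all, N is at most 3 M - 3 n. The left side of the theorem is at
-- most N + 1 and the right side is 3 M - 3 n + 3.

module OrderedField (em : ∀ {ℓ} → ExcludedMiddle ℓ) (R : CompleteOrderedField) where

  -- Arithmetic in an ordered field.

  open CompleteOrderedField R

  private
    module ToStrict = Relation.Binary.Construct.NonStrictToStrict _≡_ _≤_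

  commutativeRing : CommutativeRing 0ℓ 0ℓ
  commutativeRing = record { isCommutativeRing = isCommutativeRing }

  open CommutativeRing commutativeRing public
    using (+-identityˡ; +-identityʳ; +-comm; +-assoc; -‿inverseʳ; *-identityˡ; *-comm; zeroʳ; semiring; ring)

  open import Algebra.Properties.Semiring.Mult.TCOptimised semiring
    using (×-homo-+; ×1-homo-*; 1+×) renaming (_×_ to _×ₙ_)
  open Algebra.Properties.Ring ring
    using (-‿distribˡ-*; -‿distribʳ-*; -‿involutive; -‿+-comm; -0#≈0#)

  private
    _·1 : ℕ → ℝ
    n ·1 = n ×ₙ 1#

    -- Equality of integers computes, so with integer coefficients the ring solver can cancel terms;
    -- this homomorphism interprets the coefficients.
    toℝ : ℤ → ℝ
    toℝ (+ n)    = n ·1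
    toℝ -[1+ n ] = - (suc n ·1)

    toℝ-⊖ : ∀ m n → toℝ (m ⊖ n) ≡ m ·1 - n ·1
    toℝ-⊖ m       zero    = sym (trans (cong (m ·1 +_) -0#≈0#) (+-identityʳ (m ·1)))
    toℝ-⊖ zero    (suc n) = sym (+-identityˡ _)
    toℝ-⊖ (suc m) (suc n) = begin
      toℝ (suc m ⊖ suc n)                  ≡⟨ cong toℝ (ℤ.[1+m]⊖[1+n]≡m⊖n m n) ⟩
      toℝ (m ⊖ n)                          ≡⟨ toℝ-⊖ m n ⟩
      m ·1 - n ·1                          ≡⟨ cong (_- n ·1) (+-identityʳ (m ·1)) ⟨
      m ·1 + 0# - n ·1                     ≡⟨ cong (λ z → m ·1 + z - n ·1) (-‿inverseʳ 1#) ⟨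
      m ·1 + (1# - 1#) - n ·1              ≡⟨ cong (_- n ·1) (+-assoc (m ·1) 1# (- 1#)) ⟨
      m ·1 + 1# - 1# - n ·1                ≡⟨ +-assoc (m ·1 + 1#) (- 1#) (- (n ·1)) ⟩
      m ·1 + 1# + (- 1# + - (n ·1))        ≡⟨ cong₂ _+_ (+-comm (m ·1) 1#) (-‿+-comm 1# (n ·1)) ⟩
      (1# + m ·1) - (1# + n ·1)            ≡⟨ cong₂ _-_ (1+× m 1#) (1+× n 1#) ⟨
      suc m ·1 - suc n ·1                  ∎
      where open ≡-Reasoning

    toℝ-neg : ∀ i → toℝ (ℤ.- i) ≡ - toℝ i
    toℝ-neg (+ zero)  = sym -0#≈0#
    toℝ-neg (+ suc n) = refl
    toℝ-neg -[1+ n ]  = sym (-‿involutive _)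

    toℝ-+ : ∀ i j → toℝ (i ℤ.+ j) ≡ toℝ i + toℝ j
    toℝ-+ (+ m)    (+ n)    = ×-homo-+ 1# m n
    toℝ-+ (+ m)    -[1+ n ] = toℝ-⊖ m (suc n)
    toℝ-+ -[1+ m ] (+ n)    = trans (toℝ-⊖ n (suc m)) (+-comm (n ·1) _)
    toℝ-+ -[1+ m ] -[1+ n ] = begin
      toℝ -[1+ suc (m ℕ.+ n) ]       ≡⟨ cong toℝ (ℤ.neg-distrib-+ (+ suc m) (+ suc n)) ⟨
      toℝ (ℤ.- (+ (suc m ℕ.+ suc n)))  ≡⟨ cong -_ (×-homo-+ 1# (suc m) (suc n)) ⟩
      - (suc m ·1 + suc n ·1)        ≡⟨ -‿+-comm (suc m ·1) (suc n ·1) ⟨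
      - (suc m ·1) - suc n ·1        ∎
      where open ≡-Reasoning

    toℝ-pos-* : ∀ m j → toℝ (+ m ℤ.* j) ≡ m ·1 * toℝ j
    toℝ-pos-* m (+ n)    = trans (cong toℝ (sym (ℤ.pos-* m n))) (×1-homo-* m n)
    toℝ-pos-* m -[1+ n ] = begin
      toℝ (+ m ℤ.* ℤ.- + suc n)     ≡⟨ cong toℝ (ℤ.neg-distribʳ-* (+ m) (+ suc n)) ⟨
      toℝ (ℤ.- (+ m ℤ.* + suc n))   ≡⟨ toℝ-neg (+ m ℤ.* + suc n) ⟩
      - toℝ (+ m ℤ.* + suc n)       ≡⟨ cong -_ (toℝ-pos-* m (+ suc n)) ⟩
      - (m ·1 * suc n ·1)           ≡⟨ -‿distribʳ-* (m ·1) (suc n ·1) ⟩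
      m ·1 * - (suc n ·1)           ∎
      where open ≡-Reasoning

    toℝ-* : ∀ i j → toℝ (i ℤ.* j) ≡ toℝ i * toℝ j
    toℝ-* (+ m)    j = toℝ-pos-* m j
    toℝ-* -[1+ m ] j = begin
      toℝ (ℤ.- (+ suc m) ℤ.* j)     ≡⟨ cong toℝ (ℤ.neg-distribˡ-* (+ suc m) j) ⟨
      toℝ (ℤ.- (+ suc m ℤ.* j))     ≡⟨ toℝ-neg (+ suc m ℤ.* j) ⟩
      - toℝ (+ suc m ℤ.* j)         ≡⟨ cong -_ (toℝ-pos-* (suc m) j) ⟩
      - (suc m ·1 * toℝ j)          ≡⟨ -‿distribˡ-* (suc m ·1) (toℝ j) ⟩
      - (suc m ·1) * toℝ j          ∎
      where open ≡-Reasoning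

    ℤ-rawRing : RawRing 0ℓ 0ℓ
    ℤ-rawRing = record
      { Carrier = ℤ ; _≈_ = _≡_ ; _+_ = ℤ._+_ ; _*_ = ℤ._*_ ; -_ = ℤ.-_ ; 0# = ℤ.0ℤ ; 1# = ℤ.1ℤ }

    morphism : ℤ-rawRing -Raw-AlmostCommutative⟶ fromCommutativeRing commutativeRing
    morphism = record
      { ⟦_⟧ = toℝ ; +-homo = toℝ-+ ; *-homo = toℝ-* ; -‿homo = toℝ-neg ; 0-homo = refl ; 1-homo = refl }

  open Algebra.Solver.Ring ℤ-rawRing (fromCommutativeRing commutativeRing) morphism
    (λ i j → Maybe.map (cong toℝ) (dec⇒weaklyDec ℤ._≟_ i j)) public
    using (solve; con; _:+_; _:*_; :-_; _:-_; _:=_)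

  open IsTotalOrder isTotalOrder public
    using () renaming (refl to ≤-refl; reflexive to ≤-reflexive; trans to ≤-trans; antisym to ≤-antisym; total to ≤-total)
  open IsTotalOrder isTotalOrder using (≲-resp-≈)

  <⇒≤ : ∀ {x y} → x < y → x ≤ y
  <⇒≤ = proj₁

  <⇒≱ : ∀ {x y} → x < y → ¬ y ≤ x
  <⇒≱ (x≤y , x≢y) y≤x = x≢y (≤-antisym x≤y y≤x)

  <-irrefl : ∀ {x} → ¬ x < x
  <-irrefl x<x = proj₂ x<x refl

  <-≤-trans : ∀ {x y z} → x < y → y ≤ z → x < z
  <-≤-trans = ToStrict.<-≤-trans sym ≤-trans ≤-antisym (proj₁ ≲-resp-≈)

  ≤-<-trans : ∀ {x y z} → x ≤ y → y < z → x < z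
  ≤-<-trans = ToStrict.≤-<-trans ≤-trans ≤-antisym (proj₂ ≲-resp-≈)

  <-trans : ∀ {x y z} → x < y → y < z → x < z
  <-trans x<y y<z = <-≤-trans x<y (<⇒≤ y<z)

  data Cmp (x y : ℝ) : Set where
    lt : x < y → Cmp x y
    eq : x ≡ y → Cmp x y
    gt : y < x → Cmp x y

  cmp : ∀ x y → Cmp x y
  cmp x y with em {P = x ≡ y} | ≤-total x y
  ... | yes x≡y | _        = eq x≡y
  ... | no  x≢y | inj₁ x≤y = lt (x≤y , x≢y)
  ... | no  x≢y | inj₂ y≤x = gt (y≤x , λ y≡x → x≢y (sym y≡x))

  ≮⇒≥ : ∀ {x y} → ¬ x < y → y ≤ x
  ≮⇒≥ {x} {y} x≮y with cmp x y
  ... | lt x<y = contradiction x<y x≮y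
  ... | eq x≡y = ≤-reflexive (sym x≡y)
  ... | gt y<x = <⇒≤ y<x

  ≤-or-> : ∀ x y → x ≤ y ⊎ y < x
  ≤-or-> x y with cmp x y
  ... | lt x<y = inj₁ (<⇒≤ x<y)
  ... | eq x≡y = inj₁ (≤-reflexive x≡y)
  ... | gt y<x = inj₂ y<x

  ≤⇒0≤ : ∀ {x y} → x ≤ y → 0# ≤ y - x
  ≤⇒0≤ {x} {y} x≤y = subst (_≤ y - x) (-‿inverseʳ x) (+-monoˡ-≤ (- x) x≤y)

  x-y+y≡x : ∀ x y → x - y + y ≡ x
  x-y+y≡x = solve 2 (λ x y → x :- y :+ y := x) refl

  -- An inequality is proved by exhibiting the difference of its sides as a
  -- nonnegative expression e; the ring solver supplies the identity.
  by-nonNeg : ∀ {x y e} → 0# ≤ e → e ≡ y - x → x ≤ y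
  by-nonNeg {x} {y} 0≤e refl = subst₂ _≤_ (+-identityˡ x) (x-y+y≡x y x) (+-monoˡ-≤ x 0≤e)

  x-y≡0⇒x≡y : ∀ {x y} → x - y ≡ 0# → x ≡ y
  x-y≡0⇒x≡y {x} {y} d≡0 = trans (sym (x-y+y≡x x y)) (trans (cong (_+ y) d≡0) (+-identityˡ y))

  x≡y⇒x-y≡0 : ∀ {x y} → x ≡ y → x - y ≡ 0#
  x≡y⇒x-y≡0 {x} refl = -‿inverseʳ x

  <⇒0< : ∀ {x y} → x < y → 0# < y - x
  <⇒0< (x≤y , x≢y) = ≤⇒0≤ x≤y , λ 0≡y-x → x≢y (sym (x-y≡0⇒x≡y (sym 0≡y-x)))

  by-pos : ∀ {x y e} → 0# < e → e ≡ y - x → x < y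
  by-pos {x} {y} 0<e e≡ = by-nonNeg (<⇒≤ 0<e) e≡ ,
    λ x≡y → proj₂ 0<e (sym (trans e≡ (trans (cong (_- x) (sym x≡y)) (-‿inverseʳ x))))

  +-nonNeg : ∀ {x y} → 0# ≤ x → 0# ≤ y → 0# ≤ x + y
  +-nonNeg {x} {y} 0≤x 0≤y = ≤-trans 0≤y (subst (_≤ x + y) (+-identityˡ y) (+-monoˡ-≤ y 0≤x))

  +-pos-nonNeg : ∀ {x y} → 0# < x → 0# ≤ y → 0# < x + y
  +-pos-nonNeg {x} {y} 0<x 0≤y = <-≤-trans 0<x
    (by-nonNeg 0≤y (solve 2 (λ x y → y := x :+ y :- x) refl x y))

  +-nonNeg-pos : ∀ {x y} → 0# ≤ x → 0# < y → 0# < x + y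
  +-nonNeg-pos {x} {y} 0≤x 0<y = subst (0# <_) (+-comm y x) (+-pos-nonNeg 0<y 0≤x)

  +-pos : ∀ {x y} → 0# < x → 0# < y → 0# < x + y
  +-pos 0<x 0<y = +-pos-nonNeg 0<x (<⇒≤ 0<y)

  0≤1 : 0# ≤ 1#
  0≤1 with ≤-total 0# 1#
  ... | inj₁ 0≤1 = 0≤1
  ... | inj₂ 1≤0 = subst (0# ≤_) (solve 0 ((con (+ 0) :- con (+ 1)) :* (con (+ 0) :- con (+ 1)) := con (+ 1)) refl)
                     (*-nonNeg (≤⇒0≤ 1≤0) (≤⇒0≤ 1≤0))

  0<1 : 0# < 1#
  0<1 = 0≤1 , 0≢1

  opaque
    -- Total, with value 0 at 0, so that quotients can be written down before their denominators are
    -- known to be nonzero.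
    inv : ℝ → ℝ
    inv x with em {P = x ≡ 0#}
    ... | yes _   = 0#
    ... | no  x≢0 = proj₁ (inverse x x≢0)

    *-inv : ∀ {x} → x ≢ 0# → x * inv x ≡ 1#
    *-inv {x} x≢0 with em {P = x ≡ 0#}
    ... | yes x≡0 = contradiction x≡0 x≢0
    ... | no  x≢0 = proj₂ (inverse x x≢0)

  *-cancel-0 : ∀ {x y} → x ≢ 0# → x * y ≡ 0# → y ≡ 0#
  *-cancel-0 {x} {y} x≢0 xy≡0 = begin
    y                ≡⟨ *-identityˡ y ⟨
    1# * y           ≡⟨ cong (_* y) (*-inv x≢0) ⟨
    x * inv x * y    ≡⟨ solve 3 (λ x i y → x :* i :* y := i :* (x :* y)) refl x (inv x) y ⟩
    inv x * (x * y)  ≡⟨ cong (inv x *_) xy≡0 ⟩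
    inv x * 0#       ≡⟨ zeroʳ (inv x) ⟩
    0#               ∎
    where open ≡-Reasoning

  pos⇒≢0 : ∀ {x} → 0# < x → x ≢ 0#
  pos⇒≢0 0<x x≡0 = proj₂ 0<x (sym x≡0)

  *-pos : ∀ {x y} → 0# < x → 0# < y → 0# < x * y
  *-pos 0<x 0<y = *-nonNeg (<⇒≤ 0<x) (<⇒≤ 0<y) ,
    λ 0≡xy → pos⇒≢0 0<y (*-cancel-0 (pos⇒≢0 0<x) (sym 0≡xy))

  inv-pos : ∀ {x} → 0# < x → 0# < inv x
  inv-pos {x} 0<x with ≤-or-> (inv x) 0#
  ... | inj₂ 0<inv = 0<inv
  ... | inj₁ inv≤0 = contradiction
    (by-nonNeg (*-nonNeg (<⇒≤ 0<x) (≤⇒0≤ inv≤0))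
      (trans (solve 2 (λ x i → x :* (con (+ 0) :- i) := con (+ 0) :- x :* i) refl x (inv x))
             (cong (λ z → 0# - z) (*-inv (pos⇒≢0 0<x)))))
    (<⇒≱ 0<1)

  neg-square : ∀ x → (0# - x) * (0# - x) ≡ x * x
  neg-square = solve 1 (λ x → (con (+ 0) :- x) :* (con (+ 0) :- x) := x :* x) refl

  square-nonNeg : ∀ x → 0# ≤ x * x
  square-nonNeg x with ≤-total 0# x
  ... | inj₁ 0≤x = *-nonNeg 0≤x 0≤x
  ... | inj₂ x≤0 = subst (0# ≤_) (neg-square x) (*-nonNeg (≤⇒0≤ x≤0) (≤⇒0≤ x≤0))

  square-mono : ∀ {x y} → 0# ≤ x → x ≤ y → x * x ≤ y * y
  square-mono {x} {y} 0≤x x≤y = by-nonNeg (*-nonNeg (≤⇒0≤ x≤y) (+-nonNeg 0≤x (≤-trans 0≤x x≤y)))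
    (solve 2 (λ x y → (y :- x) :* (x :+ y) := y :* y :- x :* x) refl x y)

  *-monoˡ-≤ : ∀ {n x y} → 0# ≤ n → x ≤ y → x * n ≤ y * n
  *-monoˡ-≤ {n} {x} {y} 0≤n x≤y = by-nonNeg (*-nonNeg (≤⇒0≤ x≤y) 0≤n)
    (solve 3 (λ n x y → (y :- x) :* n := y :* n :- x :* n) refl n x y)

  *-monoʳ-< : ∀ {n x y} → 0# < n → x < y → n * x < n * y
  *-monoʳ-< {n} {x} {y} 0<n x<y = by-pos (*-pos 0<n (<⇒0< x<y))
    (solve 3 (λ n x y → n :* (y :- x) := n :* y :- n :* x) refl n x y)

  +-monoʳ-< : ∀ z {x y} → x < y → z + x < z + y
  +-monoʳ-< z {x} {y} x<y = by-pos (<⇒0< x<y)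
    (solve 3 (λ z x y → y :- x := z :+ y :- (z :+ x)) refl z x y)

  ≤-neg-swap : ∀ {x y} → x + y ≤ 0# → x ≤ 0# - y
  ≤-neg-swap {x} {y} x+y≤0 = by-nonNeg (≤⇒0≤ x+y≤0)
    (solve 2 (λ x y → con (+ 0) :- (x :+ y) := con (+ 0) :- y :- x) refl x y)

  both-signs⇒0 : ∀ {x y} → 0# < x → 0# ≤ x * y → 0# ≤ (0# - x) * y → y ≡ 0#
  both-signs⇒0 {x} {y} 0<x 0≤xy 0≤-xy = *-cancel-0 (pos⇒≢0 0<x) (≤-antisym
    (by-nonNeg 0≤-xy (solve 2 (λ x y → (con (+ 0) :- x) :* y := con (+ 0) :- x :* y) refl x y)) 0≤xy)

  0<2 : 0# < 1# + 1#
  0<2 = +-pos 0<1 0<1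

  ½ : ℝ
  ½ = inv (1# + 1#)

  0<½ : 0# < ½
  0<½ = inv-pos 0<2

  ½+½ : ½ + ½ ≡ 1#
  ½+½ = trans (solve 1 (λ h → h :+ h := con (+ 2) :* h) refl ½) (*-inv (pos⇒≢0 0<2))

  mid : ℝ → ℝ → ℝ
  mid x y = ½ * (x + y)

  ½*[x+x]≡x : ∀ x → ½ * (x + x) ≡ x
  ½*[x+x]≡x x = trans (solve 2 (λ h x → h :* (x :+ x) := (h :+ h) :* x) refl ½ x)
    (trans (cong (_* x) ½+½) (*-identityˡ x))

  x<mid : ∀ {x y} → x < y → x < mid x y
  x<mid {x} {y} x<y = by-pos (*-pos 0<½ (<⇒0< x<y))
    (trans (solve 3 (λ h x y → h :* (y :- x) := h :* (x :+ y) :- h :* (x :+ x)) refl ½ x y)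
           (cong (λ z → mid x y - z) (½*[x+x]≡x x)))

  mid<y : ∀ {x y} → x < y → mid x y < y
  mid<y {x} {y} x<y = by-pos (*-pos 0<½ (<⇒0< x<y))
    (trans (solve 3 (λ h x y → h :* (y :- x) := h :* (y :+ y) :- h :* (x :+ y)) refl ½ x y)
           (cong (_- mid x y) (½*[x+x]≡x y)))

  smaller : ∀ {ε ε′} → 0# < ε → 0# < ε′ → ∃ λ η → 0# < η × η ≤ ε × η ≤ ε′
  smaller {ε} {ε′} 0<ε 0<ε′ with ≤-total ε ε′
  ... | inj₁ ε≤ε′ = ε  , 0<ε  , ≤-refl , ε≤ε′
  ... | inj₂ ε′≤ε = ε′ , 0<ε′ , ε′≤ε   , ≤-refl

  -- Balls are given by squared radii, and this choice avoids square roots: `η` is `ε / (1 + n)`,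
  -- and `n / (1 + n)² < 1` because `(1 + n)² - n = 1 + n + n²` is positive.
  small-multiple : ∀ {n ε} → 0# ≤ n → 0# < ε → ∃ λ η → 0# < η × η * η * n < ε * ε
  small-multiple {n} {ε} 0≤n 0<ε = η , *-pos 0<ε 0<i , by-pos (*-pos (*-pos 0<ε 0<ε) 0<1-iin)
    (solve 3 (λ e i n → e :* e :* (con (+ 1) :- i :* i :* n) := e :* e :- e :* i :* (e :* i) :* n) refl ε i n)
    where
    0<1+n : 0# < 1# + n
    0<1+n = +-pos-nonNeg 0<1 0≤n
    i = inv (1# + n)
    η = ε * i
    0<i : 0# < i
    0<i = inv-pos 0<1+n
    i[1+n]≡1 : (1# + n) * i ≡ 1#
    i[1+n]≡1 = *-inv (pos⇒≢0 0<1+n)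
    0<1-iin : 0# < 1# - i * i * n
    0<1-iin = subst (0# <_) (begin
        i * i * (1# + n + n * n)                           ≡⟨ solve 2 (λ i n → i :* i :* (con (+ 1) :+ n :+ n :* n) :=
                                                               ((con (+ 1) :+ n) :* i) :* ((con (+ 1) :+ n) :* i) :- i :* i :* n) refl i n ⟩
        ((1# + n) * i) * ((1# + n) * i) - i * i * n        ≡⟨ cong (λ z → z * z - i * i * n) i[1+n]≡1 ⟩
        1# * 1# - i * i * n                                ≡⟨ cong (_- i * i * n) (*-identityˡ 1#) ⟩
        1# - i * i * n                                     ∎)
      (*-pos (*-pos 0<i 0<i) (+-pos-nonNeg 0<1+n (*-nonNeg 0≤n 0≤n)))
      where open ≡-Reasoning

-- Maxima over finite lists.

module Extremum (em : ∀ {ℓ} → ExcludedMiddle ℓ) (R : CompleteOrderedField) where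
  open CompleteOrderedField R
  open OrderedField em R

  maximum-on : ∀ {A : Set} (f : A → ℝ) (P : Pred A 0ℓ) (xs : List A) →
               (∀ x → x ∈ xs → ¬ P x) ⊎ ∃ λ x → x ∈ xs × P x × (∀ y → y ∈ xs → P y → f y ≤ f x)
  maximum-on f P []       = inj₁ λ _ ()
  maximum-on f P (x ∷ xs) with em {P = P x} | maximum-on f P xs
  ... | no ¬Px | inj₁ none = inj₁ λ { _ (here refl) → ¬Px ; y (there y∈) → none y y∈ }
  ... | no ¬Px | inj₂ (m , m∈ , Pm , max) = inj₂ (m , there m∈ , Pm ,
    λ { _ (here refl) Px → contradiction Px ¬Px ; y (there y∈) → max y y∈ })
  ... | yes Px | inj₁ none = inj₂ (x , here refl , Px ,
    λ { _ (here refl) _ → ≤-refl ; y (there y∈) Py → contradiction Py (none y y∈) })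
  ... | yes Px | inj₂ (m , m∈ , Pm , max) with ≤-total (f x) (f m)
  ...   | inj₁ fx≤fm = inj₂ (m , there m∈ , Pm , λ { _ (here refl) _ → fx≤fm ; y (there y∈) → max y y∈ })
  ...   | inj₂ fm≤fx = inj₂ (x , here refl , Px ,
    λ { _ (here refl) _ → ≤-refl ; y (there y∈) Py → ≤-trans (max y y∈ Py) fm≤fx })

-- Upper envelopes of affine functions: charging edges to regions.

module UpperEnvelope (em : ∀ {ℓ} → ExcludedMiddle ℓ) (R : CompleteOrderedField)
  (I : Set) (r s k : I → CompleteOrderedField.ℝ R) (xs : List I) (E : Pred I 0ℓ) where
  open CompleteOrderedField R
  open OrderedField em R
  open Extremum em R

  val : I → ℝ → ℝ → ℝ
  val i h t = r i * h + s i * t + k i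

  Active : I → ℝ → Set
  Active c h = ∃ λ t → ∀ i → E i → val i h t ≤ val c h t

  Exposed : I → Set
  Exposed c = ∃₂ λ h t → ∀ i → E i → i ≢ c → val i h t < val c h t

  StrictEdge : I → I → ℝ → Set
  StrictEdge a b h = ∃ λ t → val a h t ≡ val b h t × (∀ c → E c → c ≢ a → c ≢ b → val c h t < val a h t)

  strict-top : ∀ {a b h} ((t , _) : StrictEdge a b h) → ∀ i → E i → val i h t ≤ val a h t × val i h t ≤ val b h t
  strict-top {a} {b} {h} (t , a≡b , strict) i i∈E = below-a , subst (val i h t ≤_) a≡b below-a
    where
    below-a : val i h t ≤ val a h t
    below-a with em {P = i ≡ a} | em {P = i ≡ b}
    ... | yes refl | _        = ≤-refl
    ... | no _     | yes refl = ≤-reflexive (sym a≡b)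
    ... | no i≢a   | no i≢b   = <⇒≤ (strict i i∈E i≢a i≢b)

  active-a : ∀ {a b h} → StrictEdge a b h → Active a h
  active-a e@(t , _) = t , λ i i∈E → proj₁ (strict-top e i i∈E)

  active-b : ∀ {a b h} → StrictEdge a b h → Active b h
  active-b e@(t , _) = t , λ i i∈E → proj₂ (strict-top e i i∈E)

  -- As h decreases through the h-range of the edge, the edge disappears only
  -- together with the region of v.
  Born : I → I → I → Set
  Born a b v = ∃₂ λ h⁻ h⁺ → h⁻ < h⁺ × StrictEdge a b h⁻ × StrictEdge a b h⁺ ×
    (∀ h → h ≤ h⁺ → StrictEdge a b h ⊎ (∀ h′ → h′ < h → ¬ Active v h′))

  -- The edge starts where the region of c ends.
  Dead : I → I → I → Set
  Dead a b c = ∃₂ λ ρ h⁺ → ρ < h⁺ × Active c ρ ×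
    (∀ {h} → ρ < h → h ≤ h⁺ → StrictEdge a b h) × (∀ {h} → ρ < h → ¬ Active c h)

  -- The names take the viewpoint of the charged region: `lower` makes the edge a lower boundary of
  -- `b`, `upper` an upper boundary of `a`.
  data Slot (a b : I) : Fin 3 → I → Set where
    lower   : Born a b b → Slot a b zero b
    upper   : Born a b a → Slot a b (suc zero) a
    between : ∀ {c} → s a < s c → s c < s b → Dead a b c → Slot a b (suc (suc zero)) c

  -- Take the smaller of the two right abscissae. If the other edge were missing there, `v` would be
  -- inactive everywhere to the left, against the second point `h⁻` that `Born` records.
  common-born : ∀ {a b a′ b′ v} → (∀ {h} → StrictEdge a b h → Active v h) → (∀ {h} → StrictEdge a′ b′ h → Active v h) →
                Born a b v → Born a′ b′ v → ∃ λ h → StrictEdge a b h × StrictEdge a′ b′ h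
  common-born act act′ (h⁻ , h⁺ , h⁻<h⁺ , e⁻ , e⁺ , left) (h′⁻ , h′⁺ , h′⁻<h′⁺ , e′⁻ , e′⁺ , left′) with ≤-total h⁺ h′⁺
  ... | inj₁ h⁺≤h′⁺ with left′ h⁺ h⁺≤h′⁺
  ...   | inj₁ e′  = h⁺ , e⁺ , e′
  ...   | inj₂ off = contradiction (act e⁻) (off h⁻ h⁻<h⁺)
  common-born act act′ (h⁻ , h⁺ , h⁻<h⁺ , e⁻ , e⁺ , left) (h′⁻ , h′⁺ , h′⁻<h′⁺ , e′⁻ , e′⁺ , left′)
      | inj₂ h′⁺≤h⁺ with left h′⁺ h′⁺≤h⁺
  ...   | inj₁ e   = h′⁺ , e , e′⁺
  ...   | inj₂ off = contradiction (act′ e′⁻) (off h′⁻ h′⁻<h′⁺)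

  -- Both left ends are the last abscissa at which `c` is active, hence equal, and immediately to
  -- the right both edges are present.
  common-dead : ∀ {a b a′ b′ c} → Dead a b c → Dead a′ b′ c → ∃ λ h → StrictEdge a b h × StrictEdge a′ b′ h
  common-dead (ρ , h⁺ , ρ<h⁺ , act , e , off) (ρ′ , h′⁺ , ρ′<h′⁺ , act′ , e′ , off′) with cmp ρ ρ′
  ... | lt ρ<ρ′ = contradiction act′ (off ρ<ρ′)
  ... | gt ρ′<ρ = contradiction act (off′ ρ′<ρ)
  ... | eq refl with ≤-total h⁺ h′⁺
  ...   | inj₁ h⁺≤h′⁺ = h⁺ , e ρ<h⁺ ≤-refl , e′ ρ<h⁺ h⁺≤h′⁺
  ...   | inj₂ h′⁺≤h⁺ = h′⁺ , e ρ′<h′⁺ h′⁺≤h⁺ , e′ ρ′<h′⁺ ≤-refl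

  record Edge (a b : I) : Set where
    field
      a∈E : E a
      b∈E : E b
      a<b : s a < s b
      h₁ h₂ t₁ t₂ : ℝ
      h₁<h₂ : h₁ < h₂
      meet₁ : val a h₁ t₁ ≡ val b h₁ t₁
      meet₂ : val a h₂ t₂ ≡ val b h₂ t₂
      top₁  : ∀ i → E i → val i h₁ t₁ ≤ val a h₁ t₁
      top₂  : ∀ i → E i → val i h₂ t₂ ≤ val a h₂ t₂

  private
    -- On a vertical line the difference of two values changes with `t` at the rate `s i - s j`; `z`
    -- is the expression handed to `by-nonNeg` or `by-pos`.
    shift : ∀ {i j h t t′ z} → z ≡ (val i h t - val j h t) + (s i - s j) * (t′ - t) → z ≡ val i h t′ - val j h t′
    shift {i} {j} {h} {t} {t′} z≡ = trans z≡ (solve 9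
      (λ ri si ki rj sj kj h t t′ →
        ((ri :* h :+ si :* t :+ ki) :- (rj :* h :+ sj :* t :+ kj)) :+ (si :- sj) :* (t′ :- t) :=
        (ri :* h :+ si :* t′ :+ ki) :- (rj :* h :+ sj :* t′ :+ kj)) refl
      (r i) (s i) (k i) (r j) (s j) (k j) h t t′)

    shift⁻ : ∀ {i j h t t′} → (val i h t - val j h t) + (s j - s i) * (t - t′) ≡ val i h t′ - val j h t′
    shift⁻ {i} {j} {h} {t} {t′} = shift {i} {j} {h} {t} {t′} (cong (λ z → val i h t - val j h t + z)
      (solve 4 (λ si sj t t′ → (sj :- si) :* (t :- t′) := (si :- sj) :* (t′ :- t)) refl (s i) (s j) t t′))

  right : ∀ {i j h t t′} → s j ≤ s i → t ≤ t′ → val j h t ≤ val i h t → val j h t′ ≤ val i h t′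
  right sj≤si t≤t′ v = by-nonNeg (+-nonNeg (≤⇒0≤ v) (*-nonNeg (≤⇒0≤ sj≤si) (≤⇒0≤ t≤t′))) (shift refl)

  right-< : ∀ {i j h t t′} → s j < s i → t < t′ → val j h t ≤ val i h t → val j h t′ < val i h t′
  right-< sj<si t<t′ v = by-pos (+-nonNeg-pos (≤⇒0≤ v) (*-pos (<⇒0< sj<si) (<⇒0< t<t′))) (shift refl)

  left : ∀ {i j h t t′} → s i ≤ s j → t′ ≤ t → val j h t ≤ val i h t → val j h t′ ≤ val i h t′
  left {i} {j} si≤sj t′≤t v = by-nonNeg (+-nonNeg (≤⇒0≤ v) (*-nonNeg (≤⇒0≤ si≤sj) (≤⇒0≤ t′≤t))) (shift⁻ {i} {j})

  left-< : ∀ {i j h t t′} → s i < s j → t′ < t → val j h t ≤ val i h t → val j h t′ < val i h t′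
  left-< {i} {j} si<sj t′<t v = by-pos (+-nonNeg-pos (≤⇒0≤ v) (*-pos (<⇒0< si<sj) (<⇒0< t′<t))) (shift⁻ {i} {j})

  -- Above the given point `q` beats `c`, below it `p` does, and the strict alternative settles the
  -- point itself.
  covered : ∀ {p c q h t} → E p → E q → s p < s c → s c < s q →
            val c h t ≤ val p h t → val c h t ≤ val q h t →
            val c h t < val p h t ⊎ val c h t < val q h t → ¬ Active c h
  covered {p} {c} {q} {t = t} p∈E q∈E p<c c<q c≤p c≤q strict (t′ , top) with cmp t t′
  ... | lt t<t′ = <⇒≱ (right-< c<q t<t′ c≤q) (top q q∈E)
  ... | gt t′<t = <⇒≱ (left-< p<c t′<t c≤p) (top p p∈E)
  covered p∈E q∈E _ _ _ _ (inj₁ c<p) (t′ , top) | eq refl = <⇒≱ c<p (top _ p∈E)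
  covered p∈E q∈E _ _ _ _ (inj₂ c<q) (t′ , top) | eq refl = <⇒≱ c<q (top _ q∈E)

  -- On a vertical line where the three tie, `c` has the middle slope and so is nowhere larger than
  -- both others; this fails at the abscissa where `c` is exposed.
  not-collinear : ∀ {p c q} → Exposed c → E p → E q → s p < s c → s c < s q →
                  ¬ (∀ h → ∃ λ t → val c h t ≡ val p h t × val c h t ≡ val q h t)
  not-collinear (h , t , strict) p∈E q∈E p<c c<q meets with meets h
  ... | t₀ , c≡p , c≡q with ≤-total t t₀
  ...   | inj₁ t≤t₀ = <⇒≱ (strict _ p∈E λ { refl → <-irrefl p<c }) (left (<⇒≤ p<c) t≤t₀ (≤-reflexive c≡p))
  ...   | inj₂ t₀≤t = <⇒≱ (strict _ q∈E λ { refl → <-irrefl c<q }) (right (<⇒≤ c<q) t₀≤t (≤-reflexive c≡q))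

  module _ (E⊆xs : ∀ i → E i → i ∈ xs)
           (s-injective : ∀ {i j} → E i → E j → s i ≡ s j → i ≡ j)
           (exposed : ∀ i → E i → Exposed i) where

    -- The envelope is convex in `t`, so the slopes on top at the higher edge are at least those at
    -- the lower one. At equal heights the two tying functions are determined, and their slopes
    -- order them.
    strictEdges-ordered : ∀ {a b a′ b′ h} → E a → E b → E a′ → E b′ → s a < s b → s a′ < s b′ →
      StrictEdge a b h → StrictEdge a′ b′ h → (a ≡ a′ × b ≡ b′) ⊎ s b ≤ s a′ ⊎ s b′ ≤ s a
    strictEdges-ordered {a} {b} {a′} {b′} {h} a∈E b∈E a′∈E b′∈E a<b a′<b′ e@(t , _) e′@(t′ , _) with cmp t t′
    ... | lt t<t′ = inj₂ (inj₁ (≮⇒≥ λ a′<b →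
      <⇒≱ (right-< a′<b t<t′ (proj₂ (strict-top e a′ a′∈E))) (proj₁ (strict-top e′ b b∈E))))
    ... | gt t′<t = inj₂ (inj₂ (≮⇒≥ λ a<b′ →
      <⇒≱ (right-< a<b′ t′<t (proj₂ (strict-top e′ a a∈E))) (proj₁ (strict-top e b′ b′∈E))))
    ... | eq refl = inj₁ (same (endpoint a′ a′∈E (proj₁ (strict-top e′ a a∈E))) (endpoint b′ b′∈E (proj₂ (strict-top e′ a a∈E))))
      where
      endpoint : ∀ i → E i → val a h t ≤ val i h t → i ≡ a ⊎ i ≡ b
      endpoint i i∈E a≤i with em {P = i ≡ a} | em {P = i ≡ b}
      ... | yes i≡a | _       = inj₁ i≡a
      ... | no _    | yes i≡b = inj₂ i≡b
      ... | no i≢a  | no i≢b  = contradiction a≤i (<⇒≱ (proj₂ (proj₂ e) i i∈E i≢a i≢b))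
      same : a′ ≡ a ⊎ a′ ≡ b → b′ ≡ a ⊎ b′ ≡ b → a ≡ a′ × b ≡ b′
      same (inj₁ refl) (inj₁ refl) = contradiction a′<b′ <-irrefl
      same (inj₁ refl) (inj₂ refl) = refl , refl
      same (inj₂ refl) (inj₁ refl) = contradiction (<-trans a<b a′<b′) <-irrefl
      same (inj₂ refl) (inj₂ refl) = contradiction a′<b′ <-irrefl

    -- Whichever of the three has the middle slope contradicts `not-collinear`.
    gap-collinear : ∀ {a b c} → E a → E b → E c → s a < s b → c ≢ a → c ≢ b →
      ¬ (∀ h → ∃ λ t → val a h t ≡ val b h t × val a h t ≡ val c h t)
    gap-collinear {a} {b} {c} a∈E b∈E c∈E a<b c≢a c≢b meets with cmp (s c) (s a) | cmp (s c) (s b)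
    ... | eq c≡a | _      = c≢a (s-injective c∈E a∈E c≡a)
    ... | _      | eq c≡b = c≢b (s-injective c∈E b∈E c≡b)
    ... | lt c<a | _      = not-collinear (exposed a a∈E) c∈E b∈E c<a a<b
      λ h → let t , a≡b , a≡c = meets h in t , a≡c , a≡b
    ... | gt a<c | lt c<b = not-collinear (exposed c c∈E) a∈E b∈E a<c c<b
      λ h → let t , a≡b , a≡c = meets h in t , sym a≡c , trans (sym a≡c) a≡b
    ... | gt _   | gt b<c = not-collinear (exposed b b∈E) a∈E c∈E a<b b<c
      λ h → let t , a≡b , a≡c = meets h in t , sym a≡b , trans (sym a≡b) a≡c

    -- The line that carries an edge, and the left end of the edge.

    module EdgeLine {a b} (e : Edge a b) where
      open Edge e

      m n : ℝ
      m = (t₂ - t₁) * inv (h₂ - h₁)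
      n = t₁ - m * h₁

      height : ℝ → ℝ
      height h = m * h + n

      height₁ : height h₁ ≡ t₁
      height₁ = solve 3 (λ m h t → m :* h :+ (t :- m :* h) := t) refl m h₁ t₁

      height₂ : height h₂ ≡ t₂
      height₂ = begin
        m * h₂ + (t₁ - m * h₁)                       ≡⟨ solve 5 (λ h₁ h₂ t₁ t₂ i →
                                                          (t₂ :- t₁) :* i :* h₂ :+ (t₁ :- (t₂ :- t₁) :* i :* h₁) :=
                                                          (t₂ :- t₁) :* ((h₂ :- h₁) :* i) :+ t₁) refl h₁ h₂ t₁ t₂ _ ⟩
        (t₂ - t₁) * ((h₂ - h₁) * inv (h₂ - h₁)) + t₁ ≡⟨ cong (λ z → (t₂ - t₁) * z + t₁) (*-inv (pos⇒≢0 (<⇒0< h₁<h₂))) ⟩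
        (t₂ - t₁) * 1# + t₁                          ≡⟨ solve 2 (λ t₁ t₂ → (t₂ :- t₁) :* con (ℤ.+ 1) :+ t₁ := t₂) refl t₁ t₂ ⟩
        t₂                                           ∎
        where open ≡-Reasoning

      -- Since `a` and `b` agree along this line, this is the distance in value by which `c` stays
      -- below the edge: an affine function of `h` with derivative `rate c`.
      gap : I → ℝ → ℝ
      gap c h = val a h (height h) - val c h (height h)

      rate : I → ℝ
      rate c = (r a - r c) + (s a - s c) * m

      gap-difference : ∀ c h h′ → gap c h′ ≡ gap c h + rate c * (h′ - h)
      gap-difference c h h′ = solve 10
        (λ ra sa ka rc sc kc m n h h′ →
          (ra :* h′ :+ sa :* (m :* h′ :+ n) :+ ka) :- (rc :* h′ :+ sc :* (m :* h′ :+ n) :+ kc) :=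
          ((ra :* h :+ sa :* (m :* h :+ n) :+ ka) :- (rc :* h :+ sc :* (m :* h :+ n) :+ kc)) :+
          ((ra :- rc) :+ (sa :- sc) :* m) :* (h′ :- h)) refl
        (r a) (s a) (k a) (r c) (s c) (k c) m n h h′

      gap-nonNeg₁ : ∀ c → E c → 0# ≤ gap c h₁
      gap-nonNeg₁ c c∈E = subst (λ t → 0# ≤ val a h₁ t - val c h₁ t) (sym height₁) (≤⇒0≤ (top₁ c c∈E))

      gap-nonNeg₂ : ∀ c → E c → 0# ≤ gap c h₂
      gap-nonNeg₂ c c∈E = subst (λ t → 0# ≤ val a h₂ t - val c h₂ t) (sym height₂) (≤⇒0≤ (top₂ c c∈E))

      gap-vanishes : ∀ c {h h′} → h < h′ → gap c h ≡ 0# → gap c h′ ≡ 0# → ∀ x → gap c x ≡ 0#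
      gap-vanishes c {h} {h′} h<h′ g≡0 g′≡0 x = begin
        gap c x                     ≡⟨ gap-difference c h x ⟩
        gap c h + rate c * (x - h)  ≡⟨ cong₂ (λ y z → y + z * (x - h)) g≡0 rate≡0 ⟩
        0# + 0# * (x - h)           ≡⟨ solve 2 (λ h x → con (ℤ.+ 0) :+ con (ℤ.+ 0) :* (x :- h) := con (ℤ.+ 0)) refl h x ⟩
        0#                          ∎
        where
        open ≡-Reasoning
        rate≡0 : rate c ≡ 0#
        rate≡0 = *-cancel-0 (pos⇒≢0 (<⇒0< h<h′)) (begin
          (h′ - h) * rate c              ≡⟨ *-comm _ _ ⟩
          rate c * (h′ - h)              ≡⟨ +-identityˡ _ ⟨
          0# + rate c * (h′ - h)         ≡⟨ cong (_+ rate c * (h′ - h)) g≡0 ⟨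
          gap c h + rate c * (h′ - h)    ≡⟨ gap-difference c h h′ ⟨
          gap c h′                       ≡⟨ g′≡0 ⟩
          0#                             ∎)

      gap-a : ∀ h → gap a h ≡ 0#
      gap-a h = -‿inverseʳ _

      gap-b : ∀ h → gap b h ≡ 0#
      gap-b = gap-vanishes b h₁<h₂
        (trans (cong (λ t → val a h₁ t - val b h₁ t) height₁) (x≡y⇒x-y≡0 meet₁))
        (trans (cong (λ t → val a h₂ t - val b h₂ t) height₂) (x≡y⇒x-y≡0 meet₂))

      a≡b : ∀ h → val a h (height h) ≡ val b h (height h)
      a≡b h = x-y≡0⇒x≡y (gap-b h)

      h₀ : ℝ
      h₀ = mid h₁ h₂

      gap-decreasing : ∀ c {h h′} → rate c ≤ 0# → h ≤ h′ → gap c h′ ≤ gap c h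
      gap-decreasing c {h} {h′} rate≤0 h≤h′ = by-nonNeg (*-nonNeg (≤⇒0≤ rate≤0) (≤⇒0≤ h≤h′))
        (trans (solve 4 (λ g ρ h h′ → (con (ℤ.+ 0) :- ρ) :* (h′ :- h) := g :- (g :+ ρ :* (h′ :- h))) refl
                 (gap c h) (rate c) h h′)
               (cong (λ z → gap c h - z) (sym (gap-difference c h h′))))

      gap-decreasing-< : ∀ c {h h′} → rate c < 0# → h < h′ → gap c h′ < gap c h
      gap-decreasing-< c {h} {h′} rate<0 h<h′ = by-pos (*-pos (<⇒0< rate<0) (<⇒0< h<h′))
        (trans (solve 4 (λ g ρ h h′ → (con (ℤ.+ 0) :- ρ) :* (h′ :- h) := g :- (g :+ ρ :* (h′ :- h))) refl
                 (gap c h) (rate c) h h′)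
               (cong (λ z → gap c h - z) (sym (gap-difference c h h′))))

      gap-increasing-< : ∀ c {h h′} → 0# < rate c → h < h′ → gap c h < gap c h′
      gap-increasing-< c {h} {h′} 0<rate h<h′ = by-pos (*-pos 0<rate (<⇒0< h<h′))
        (trans (solve 4 (λ g ρ h h′ → ρ :* (h′ :- h) := (g :+ ρ :* (h′ :- h)) :- g) refl
                 (gap c h) (rate c) h h′)
               (cong (_- gap c h) (sym (gap-difference c h h′))))

      gap-increasing : ∀ c {h h′} → 0# < rate c → h ≤ h′ → gap c h ≤ gap c h′
      gap-increasing c {h} {h′} 0<rate h≤h′ with em {P = h ≡ h′}
      ... | yes refl = ≤-refl
      ... | no  h≢h′ = <⇒≤ (gap-increasing-< c 0<rate (h≤h′ , h≢h′))

      -- An affine function that is nonnegative at `h₁` and `h₂` is positive at their midpoint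
      -- unless it vanishes identically, which `gap-collinear` excludes.
      gap-positive : ∀ c → E c → c ≢ a → c ≢ b → 0# < gap c h₀
      gap-positive c c∈E c≢a c≢b with cmp (rate c) 0#
      ... | lt rate<0 = ≤-<-trans (gap-nonNeg₂ c c∈E) (gap-decreasing-< c rate<0 (mid<y h₁<h₂))
      ... | gt 0<rate = ≤-<-trans (gap-nonNeg₁ c c∈E) (gap-increasing-< c 0<rate (x<mid h₁<h₂))
      ... | eq rate≡0 = subst (0# ≤_) (sym (constant h₀)) (gap-nonNeg₁ c c∈E) ,
        λ 0≡gap → gap-collinear a∈E b∈E c∈E a<b c≢a c≢b
          λ h → height h , a≡b h , x-y≡0⇒x≡y (trans (constant h) (trans (sym (constant h₀)) (sym 0≡gap)))
        where
        constant : ∀ h → gap c h ≡ gap c h₁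
        constant h = trans (gap-difference c h₁ h) (trans (cong (λ z → gap c h₁ + z * (h - h₁)) rate≡0)
          (solve 3 (λ g x y → g :+ con (ℤ.+ 0) :* (x :- y) := g) refl (gap c h₁) h h₁))

      root : I → ℝ
      root c = h₀ - gap c h₀ * inv (rate c)

      gap-root : ∀ c → 0# < rate c → gap c (root c) ≡ 0#
      gap-root c 0<rate = begin
        gap c (root c)                                ≡⟨ gap-difference c h₀ (root c) ⟩
        gap c h₀ + rate c * (root c - h₀)             ≡⟨ solve 4 (λ g ρ i h →
                                                           g :+ ρ :* (h :- g :* i :- h) := g :- g :* (ρ :* i)) refl
                                                           (gap c h₀) (rate c) _ h₀ ⟩
        gap c h₀ - gap c h₀ * (rate c * inv (rate c)) ≡⟨ cong (λ z → gap c h₀ - gap c h₀ * z) (*-inv (pos⇒≢0 0<rate)) ⟩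
        gap c h₀ - gap c h₀ * 1#                      ≡⟨ solve 1 (λ g → g :- g :* con (ℤ.+ 1) := con (ℤ.+ 0)) refl (gap c h₀) ⟩
        0#                                            ∎
        where open ≡-Reasoning

      strictEdge : ∀ {h} → (∀ c → E c → c ≢ a → c ≢ b → 0# < gap c h) → StrictEdge a b h
      strictEdge {h} pos = height h , a≡b h , λ c c∈E c≢a c≢b → by-pos (pos c c∈E c≢a c≢b) refl

      data LeftEnd : Set where
        unbounded : (∀ {h} → h ≤ h₀ → StrictEdge a b h) → LeftEnd
        bounded   : ∀ c ρ → E c → c ≢ a → c ≢ b → ρ < h₀ → 0# < rate c → gap c ρ ≡ 0# →
                    (∀ i → E i → 0# ≤ gap i ρ) →
                    (∀ {h} → ρ < h → h ≤ h₀ → StrictEdge a b h) → LeftEnd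

      rate≢0 : ∀ {c} → 0# < rate c → ¬ (∀ h → gap c h ≡ 0#)
      rate≢0 {c} 0<rate gap≡0 = <-irrefl (subst₂ _<_ (gap≡0 h₁) (gap≡0 h₂) (gap-increasing-< c 0<rate h₁<h₂))

      -- Going left from `h₀` only gaps of positive rate shrink, so the edge lasts until the largest
      -- of their roots, or forever if there is none.
      leftEnd : LeftEnd
      leftEnd with maximum-on root (λ c → E c × 0# < rate c) xs
      ... | inj₁ none = unbounded λ h≤h₀ → strictEdge λ c c∈E c≢a c≢b →
        <-≤-trans (gap-positive c c∈E c≢a c≢b)
          (gap-decreasing c (≮⇒≥ λ 0<rate → none c (E⊆xs c c∈E) (c∈E , 0<rate)) h≤h₀)
      ... | inj₂ (c , _ , (c∈E , 0<rate) , last) =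
        bounded c (root c) c∈E c≢a c≢b root<h₀ 0<rate (gap-root c 0<rate) nonNeg
          λ ρ<h h≤h₀ → strictEdge λ i i∈E i≢a i≢b → positive ρ<h h≤h₀ i i∈E i≢a i≢b (≤-or-> (rate i) 0#)
        where
        c≢a : c ≢ a
        c≢a refl = rate≢0 0<rate gap-a
        c≢b : c ≢ b
        c≢b refl = rate≢0 0<rate gap-b
        root<h₀ : root c < h₀
        root<h₀ with ≤-or-> h₀ (root c)
        ... | inj₂ root<h₀ = root<h₀
        ... | inj₁ h₀≤root = contradiction (gap-increasing c 0<rate h₀≤root)
          (<⇒≱ (subst (_< gap c h₀) (sym (gap-root c 0<rate)) (gap-positive c c∈E c≢a c≢b)))
        positive : ∀ {h} → root c < h → h ≤ h₀ → ∀ i → E i → i ≢ a → i ≢ b → rate i ≤ 0# ⊎ 0# < rate i → 0# < gap i h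
        positive ρ<h h≤h₀ i i∈E i≢a i≢b (inj₁ rate≤0) =
          <-≤-trans (gap-positive i i∈E i≢a i≢b) (gap-decreasing i rate≤0 h≤h₀)
        positive {h} ρ<h h≤h₀ i i∈E i≢a i≢b (inj₂ 0<rate) = subst (_< gap i h) (gap-root i 0<rate)
          (gap-increasing-< i 0<rate (≤-<-trans (last i (E⊆xs i i∈E) (i∈E , 0<rate)) ρ<h))
        nonNeg : ∀ i → E i → 0# ≤ gap i (root c)
        nonNeg i i∈E with ≤-or-> (rate i) 0#
        ... | inj₂ 0<rate = subst (_≤ gap i (root c)) (gap-root i 0<rate)
          (gap-increasing i 0<rate (last i (E⊆xs i i∈E) (i∈E , 0<rate)))
        ... | inj₁ rate≤0 with em {P = i ≡ a} | em {P = i ≡ b}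
        ...   | yes refl | _        = ≤-reflexive (sym (gap-a _))
        ...   | no _     | yes refl = ≤-reflexive (sym (gap-b _))
        ...   | no i≢a   | no i≢b   =
          ≤-trans (<⇒≤ (gap-positive i i∈E i≢a i≢b)) (gap-decreasing i rate≤0 (<⇒≤ root<h₀))

      -- Along the line of the edge, `c` is above it to the left of `ρ` and below it to the right.
      -- If `a` or `b` has the middle slope, that region is covered to the left and starts with the
      -- edge; if `c` has it, its region is covered to the right and ends at `ρ`.
      slot : ∃₂ λ j v → E v × Slot a b j v
      slot with leftEnd
      -- The edge never stops on the left, so `h₀ - 1` only provides a second point of it.
      ... | unbounded e = _ , _ , b∈E , lower (h₀ - 1# , h₀ , h₀-1<h₀ , e (<⇒≤ h₀-1<h₀) , e ≤-refl , λ h h≤h₀ → inj₁ (e h≤h₀))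
        where
        h₀-1<h₀ : h₀ - 1# < h₀
        h₀-1<h₀ = by-pos 0<1 (solve 1 (λ h → con (ℤ.+ 1) := h :- (h :- con (ℤ.+ 1))) refl h₀)
      ... | bounded c ρ c∈E c≢a c≢b ρ<h₀ 0<rate root nonNeg e = position (cmp (s c) (s a)) (cmp (s c) (s b))
        where
        above : ∀ {h} → h < ρ → val a h (height h) < val c h (height h)
        above {h} h<ρ = by-pos (<⇒0< (subst (gap c h <_) root (gap-increasing-< c 0<rate h<ρ)))
          (solve 2 (λ x y → con (ℤ.+ 0) :- (x :- y) := y :- x) refl (val a h (height h)) (val c h (height h)))

        below : ∀ {h} → ρ < h → val c h (height h) < val a h (height h)
        below {h} ρ<h = by-pos (subst (_< gap c h) root (gap-increasing-< c 0<rate ρ<h)) refl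

        born : ∀ {v} → (∀ h → h < ρ → ¬ Active v h) → Born a b v
        born {v} off = mid ρ h₀ , h₀ , mid<y ρ<h₀ , e (x<mid ρ<h₀) (<⇒≤ (mid<y ρ<h₀)) , e ρ<h₀ ≤-refl , λ h → left-or-right h (≤-or-> h ρ)
          where
          left-or-right : ∀ h → h ≤ ρ ⊎ ρ < h → h ≤ h₀ → StrictEdge a b h ⊎ (∀ h′ → h′ < h → ¬ Active v h′)
          left-or-right h (inj₁ h≤ρ) _    = inj₂ λ h′ h′<h → off h′ (<-≤-trans h′<h h≤ρ)
          left-or-right h (inj₂ ρ<h) h≤h₀ = inj₁ (e ρ<h h≤h₀)

        active-c : Active c ρ
        active-c = height ρ , λ i i∈E → subst (val i ρ (height ρ) ≤_) (x-y≡0⇒x≡y root) (by-nonNeg (nonNeg i i∈E) refl)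

        position : Cmp (s c) (s a) → Cmp (s c) (s b) → ∃₂ λ j v → E v × Slot a b j v
        position (eq c≡a) _        = contradiction (s-injective c∈E a∈E c≡a) c≢a
        position _        (eq c≡b) = contradiction (s-injective c∈E b∈E c≡b) c≢b
        position (lt c<a) _        = _ , _ , a∈E , upper (born λ h h<ρ →
          covered c∈E b∈E c<a a<b (<⇒≤ (above h<ρ)) (≤-reflexive (a≡b h)) (inj₁ (above h<ρ)))
        position (gt _)   (gt b<c) = _ , _ , b∈E , lower (born λ h h<ρ →
          let b<c′ = subst (_< val c h (height h)) (a≡b h) (above h<ρ) in
          covered a∈E c∈E a<b b<c (≤-reflexive (sym (a≡b h))) (<⇒≤ b<c′) (inj₂ b<c′))
        position (gt a<c) (lt c<b) = _ , _ , c∈E , between a<c c<b (ρ , h₀ , ρ<h₀ , active-c , e , λ {h} ρ<h →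
          covered a∈E b∈E a<c c<b (<⇒≤ (below ρ<h)) (subst (val c h (height h) ≤_) (a≡b h) (<⇒≤ (below ρ<h))) (inj₁ (below ρ<h)))

    -- In the three roles the slope intervals share their upper end, their lower end, or the
    -- interior value `s c`; so they overlap, and `strictEdges-ordered` leaves only equality.
    slot-injective : ∀ {a b a′ b′ j v} → Edge a b → Edge a′ b′ → Slot a b j v → Slot a′ b′ j v → a ≡ a′ × b ≡ b′
    slot-injective {a} {b} {a′} {b′} e e′ = decide
      where
      module e = Edge e
      module e′ = Edge e′

      ordered : ∀ {h} → StrictEdge a b h × StrictEdge a′ b′ h → (a ≡ a′ × b ≡ b′) ⊎ s b ≤ s a′ ⊎ s b′ ≤ s a
      ordered (f , f′) = strictEdges-ordered e.a∈E e.b∈E e′.a∈E e′.b∈E e.a<b e′.a<b f f′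

      decide : ∀ {j v} → Slot a b j v → Slot a′ b′ j v → a ≡ a′ × b ≡ b′
      decide (lower born) (lower born′) with ordered (proj₂ (common-born active-b active-b born born′))
      ... | inj₁ same        = same
      ... | inj₂ (inj₁ b≤a′) = contradiction b≤a′ (<⇒≱ e′.a<b)
      ... | inj₂ (inj₂ b≤a)  = contradiction b≤a (<⇒≱ e.a<b)
      decide (upper born) (upper born′) with ordered (proj₂ (common-born active-a active-a born born′))
      ... | inj₁ same        = same
      ... | inj₂ (inj₁ b≤a)  = contradiction b≤a (<⇒≱ e.a<b)
      ... | inj₂ (inj₂ b′≤a) = contradiction b′≤a (<⇒≱ e′.a<b)
      decide (between a<c c<b dead) (between a′<c c<b′ dead′) with ordered (proj₂ (common-dead dead dead′))
      ... | inj₁ same        = same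
      ... | inj₂ (inj₁ b≤a′) = contradiction b≤a′ (<⇒≱ (<-trans a′<c c<b))
      ... | inj₂ (inj₂ b′≤a) = contradiction b′≤a (<⇒≱ (<-trans a<c c<b′))

    module EdgeSlots {n : ℕ} (index : ∀ i → E i → Fin (suc n))
      (index-injective : ∀ {i j} (p : E i) (q : E j) → index i p ≡ index j q → i ≡ j)
      {lo hi : I} (lo∈E : E lo) (lowest : ∀ i → E i → s lo ≤ s i) (hi∈E : E hi) (highest : ∀ i → E i → s i ≤ s hi) where

      -- The lowest region has no lower edge and lies between no two others; the
      -- highest one has no upper edge.
      spare : Fin 3 → Fin (suc n)
      spare zero             = index lo lo∈E
      spare (suc zero)       = index hi hi∈E
      spare (suc (suc zero)) = index lo lo∈E

      slot≢spare : ∀ {a b j v} → Edge a b → (v∈E : E v) → Slot a b j v → spare j ≢ index v v∈E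
      slot≢spare e v∈E (lower _) same with refl ← index-injective lo∈E v∈E same = <⇒≱ a<b (lowest _ a∈E)
        where open Edge e
      slot≢spare e v∈E (upper _) same with refl ← index-injective hi∈E v∈E same = <⇒≱ a<b (highest _ b∈E)
        where open Edge e
      slot≢spare e v∈E (between a<c _ _) same with refl ← index-injective lo∈E v∈E same = <⇒≱ a<c (lowest _ a∈E)
        where open Edge e

      opaque
        -- Punching out the spare region of each role turns 3 (n + 1) possible charges into 3 n.
        edgeSlot : ∀ {a b} → Edge a b → Fin (3 ℕ.* n)
        edgeSlot e = let j , _ , v∈E , f = EdgeLine.slot e in combine j (punchOut (slot≢spare e v∈E f))

        edgeSlot-injective : ∀ {a b a′ b′} (e : Edge a b) (e′ : Edge a′ b′) → edgeSlot e ≡ edgeSlot e′ → a ≡ a′ × b ≡ b′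
        edgeSlot-injective e e′ same with EdgeLine.slot e | EdgeLine.slot e′
        ... | j , v , v∈E , f | j′ , v′ , v′∈E , f′ with Fin.combine-injective j _ j′ _ same
        ... | refl , same-v
          with refl ← index-injective v∈E v′∈E (Fin.punchOut-injective (slot≢spare e v∈E f) (slot≢spare e′ v′∈E f′) same-v)
          = slot-injective e e′ f f′

-- Balls and affine functions in the Euclidean plane.

module Plane (em : ∀ {ℓ} → ExcludedMiddle ℓ) (R : CompleteOrderedField) where
  open CompleteOrderedField R
  open OrderedField em R
  open TropicalPlane R

  norm-nonNeg : ∀ v → 0# ≤ ⟨ v , v ⟩
  norm-nonNeg (v₁ , v₂) = +-nonNeg (square-nonNeg v₁) (square-nonNeg v₂)

  ball-mono : ∀ {x ε ε′} → 0# ≤ ε → ε ≤ ε′ → Ball x ε ⊆ Ball x ε′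
  ball-mono 0≤ε ε≤ε′ y∈B = <-≤-trans y∈B (square-mono 0≤ε ε≤ε′)

  near-mono : ∀ {x} {P Q : Pred Point 0ℓ} → P ⊆ Q → Near x (_⊆ P) → Near x (_⊆ Q)
  near-mono P⊆Q (ε , 0<ε , B⊆P) = ε , 0<ε , λ y∈B → P⊆Q (B⊆P y∈B)

  near-∩ : ∀ {x} {P Q : Pred Point 0ℓ} → Near x (_⊆ P) → Near x (_⊆ Q) → Near x (_⊆ P ∩ Q)
  near-∩ (ε , 0<ε , B⊆P) (ε′ , 0<ε′ , B⊆Q) with smaller 0<ε 0<ε′
  ... | η , 0<η , η≤ε , η≤ε′ = η , 0<η , λ y∈B → B⊆P (ball-mono (<⇒≤ 0<η) η≤ε y∈B) , B⊆Q (ball-mono (<⇒≤ 0<η) η≤ε′ y∈B)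

  near-all : ∀ {A : Set} {x} (xs : List A) (P : A → Pred Point 0ℓ) → (∀ a → a ∈ xs → Near x (_⊆ P a)) →
             Near x (_⊆ λ y → ∀ a → a ∈ xs → P a y)
  near-all []       P near = 1# , 0<1 , λ _ _ ()
  near-all (a ∷ xs) P near = near-mono (λ { (p , ps) _ (here refl) → p ; (p , ps) b (there b∈) → ps b b∈ })
    (near-∩ (near a (here refl)) (near-all xs P λ b b∈ → near b (there b∈)))

  ball-center : ∀ {x ε} → 0# < ε → Ball x ε x
  ball-center {x₁ , x₂} 0<ε = subst (_< _) (sym (solve 2 (λ x y → (x :- x) :* (x :- x) :+ (y :- y) :* (y :- y) := con (ℤ.+ 0)) refl x₁ x₂))
    (*-pos 0<ε 0<ε)

  norm-scale : ∀ τ d → ⟨ τ · d , τ · d ⟩ ≡ τ * τ * ⟨ d , d ⟩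
  norm-scale τ (d₁ , d₂) = solve 3 (λ t d₁ d₂ →
    t :* d₁ :* (t :* d₁) :+ t :* d₂ :* (t :* d₂) := t :* t :* (d₁ :* d₁ :+ d₂ :* d₂)) refl τ d₁ d₂

  x+v-x≡v : ∀ x v → x +ᵖ v -ᵖ x ≡ v
  x+v-x≡v (x₁ , x₂) (v₁ , v₂) = cong₂ _,_ (cancel x₁ v₁) (cancel x₂ v₂)
    where
    cancel : ∀ x y → x + y - x ≡ y
    cancel = solve 2 (λ x y → x :+ y :- x := y) refl

  -- The bound is on `τ * τ`, so that points on both sides of `x` are covered.
  ball-ray : ∀ {x ε} d → 0# < ε → ∃ λ η → 0# < η × (∀ τ → τ * τ ≤ η * η → Ball x ε (x +ᵖ τ · d))
  ball-ray {x} {ε} d 0<ε =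
    let η , 0<η , small = small-multiple (norm-nonNeg d) 0<ε in
    η , 0<η , λ τ τ²≤η² → subst (λ v → ⟨ v , v ⟩ < ε * ε) (sym (x+v-x≡v x (τ · d)))
      (subst (_< ε * ε) (sym (norm-scale τ d)) (≤-<-trans (*-monoˡ-≤ (norm-nonNeg d) τ²≤η²) small))

  eval-ray : ∀ f x τ d → eval f (x +ᵖ τ · d) ≡ eval f x + τ * ⟨ gradient f , d ⟩
  eval-ray (affine (u₁ , u₂) c) (x₁ , x₂) τ (d₁ , d₂) = solve 8
    (λ u₁ u₂ c x₁ x₂ t d₁ d₂ → u₁ :* (x₁ :+ t :* d₁) :+ u₂ :* (x₂ :+ t :* d₂) :+ c :=
       u₁ :* x₁ :+ u₂ :* x₂ :+ c :+ t :* (u₁ :* d₁ :+ u₂ :* d₂)) refl u₁ u₂ c x₁ x₂ τ d₁ d₂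

  eval-step : ∀ f x y → eval f y ≡ eval f x + ⟨ gradient f , y -ᵖ x ⟩
  eval-step (affine (u₁ , u₂) c) (x₁ , x₂) (y₁ , y₂) = solve 7
    (λ u₁ u₂ c x₁ x₂ y₁ y₂ → u₁ :* y₁ :+ u₂ :* y₂ :+ c :=
       u₁ :* x₁ :+ u₂ :* x₂ :+ c :+ (u₁ :* (y₁ :- x₁) :+ u₂ :* (y₂ :- x₂))) refl u₁ u₂ c x₁ x₂ y₁ y₂

  -- Lagrange's identity: the sides differ by the square of the determinant of `u` and `v`.
  cauchy-schwarz : ∀ u v → ⟨ u , v ⟩ * ⟨ u , v ⟩ ≤ ⟨ u , u ⟩ * ⟨ v , v ⟩
  cauchy-schwarz (u₁ , u₂) (v₁ , v₂) = by-nonNeg (square-nonNeg (u₁ * v₂ - u₂ * v₁)) (solve 4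
    (λ u₁ u₂ v₁ v₂ → (u₁ :* v₂ :- u₂ :* v₁) :* (u₁ :* v₂ :- u₂ :* v₁) :=
      (u₁ :* u₁ :+ u₂ :* u₂) :* (v₁ :* v₁ :+ v₂ :* v₂) :- (u₁ :* v₁ :+ u₂ :* v₂) :* (u₁ :* v₁ :+ u₂ :* v₂))
    refl u₁ u₂ v₁ v₂)

  -- If the value fell to zero or below, `f` would have dropped by at least `eval f x`; but by
  -- Cauchy-Schwarz the square of its change is at most `η * η * ⟨ u , u ⟩`, which `η` makes smaller
  -- than the square of `eval f x`.
  positive-near : ∀ f x → 0# < eval f x → Near x (_⊆ λ y → 0# < eval f y)
  positive-near f x 0<fx =
    let η , 0<η , small = small-multiple (norm-nonNeg (gradient f)) 0<fx in
    η , 0<η , λ {y} y∈B → positive η small y y∈B (≤-or-> (eval f y) 0#)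
    where
    u = gradient f
    positive : ∀ η → η * η * ⟨ u , u ⟩ < eval f x * eval f x →
               ∀ y → Ball x η y → eval f y ≤ 0# ⊎ 0# < eval f y → 0# < eval f y
    positive η small y _   (inj₂ 0<fy) = 0<fy
    positive η small y y∈B (inj₁ fy≤0) = contradiction fx²≤ (<⇒≱ small)
      where
      v = y -ᵖ x
      fx≤-⟨u,v⟩ : eval f x ≤ 0# - ⟨ u , v ⟩
      fx≤-⟨u,v⟩ = ≤-neg-swap (subst (_≤ 0#) (eval-step f x y) fy≤0)
      ⟨u,v⟩²≤ : ⟨ u , v ⟩ * ⟨ u , v ⟩ ≤ η * η * ⟨ u , u ⟩
      ⟨u,v⟩²≤ = ≤-trans (cauchy-schwarz u v) (subst (_≤ η * η * ⟨ u , u ⟩) (*-comm ⟨ v , v ⟩ ⟨ u , u ⟩)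
        (*-monoˡ-≤ (norm-nonNeg u) (<⇒≤ y∈B)))
      fx²≤ : eval f x * eval f x ≤ η * η * ⟨ u , u ⟩
      fx²≤ = ≤-trans (subst (eval f x * eval f x ≤_) (neg-square ⟨ u , v ⟩) (square-mono (<⇒≤ 0<fx) fx≤-⟨u,v⟩)) ⟨u,v⟩²≤

  infixl 6 _-ᵃ_
  _-ᵃ_ : Affine → Affine → Affine
  f -ᵃ g = affine (gradient f -ᵖ gradient g) (const f - const g)

  eval-ᵃ : ∀ f g x → eval (f -ᵃ g) x ≡ eval f x - eval g x
  eval-ᵃ (affine (u₁ , u₂) c) (affine (v₁ , v₂) d) (x₁ , x₂) = solve 8
    (λ u₁ u₂ c v₁ v₂ d x₁ x₂ → (u₁ :- v₁) :* x₁ :+ (u₂ :- v₂) :* x₂ :+ (c :- d) :=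
      u₁ :* x₁ :+ u₂ :* x₂ :+ c :- (v₁ :* x₁ :+ v₂ :* x₂ :+ d)) refl u₁ u₂ c v₁ v₂ d x₁ x₂

  <-near : ∀ f g x → eval f x < eval g x → Near x (_⊆ λ y → eval f y < eval g y)
  <-near f g x fx<gx = near-mono (λ {y} 0< → by-pos 0< (eval-ᵃ g f y))
    (positive-near (g -ᵃ f) x (subst (0# <_) (sym (eval-ᵃ g f x)) (<⇒0< fx<gx)))

  -- A nonnegative affine function with an interior zero is zero: compare the
  -- values at x ± τ d for a small τ.
  nonNeg⇒constant : ∀ f x {ε} → 0# < ε → (∀ y → Ball x ε y → 0# ≤ eval f y) → eval f x ≡ 0# → ∀ d → ⟨ gradient f , d ⟩ ≡ 0#
  nonNeg⇒constant f x 0<ε nonNeg fx≡0 d =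
    let η , 0<η , ray = ball-ray {x} d 0<ε in
    both-signs⇒0 0<η
      (subst (0# ≤_) (at η) (nonNeg (x +ᵖ η · d) (ray η ≤-refl)))
      (subst (0# ≤_) (at (0# - η)) (nonNeg (x +ᵖ (0# - η) · d) (ray (0# - η) (≤-reflexive (neg-square η)))))
    where
    at : ∀ τ → eval f (x +ᵖ τ · d) ≡ τ * ⟨ gradient f , d ⟩
    at τ = trans (eval-ray f x τ d) (trans (cong (_+ τ * ⟨ gradient f , d ⟩) fx≡0) (+-identityˡ (τ * ⟨ gradient f , d ⟩)))

  e₁ e₂ : Point
  e₁ = 1# , 0#
  e₂ = 0# , 1#

  ⟨u,e₁⟩ : ∀ u → ⟨ u , e₁ ⟩ ≡ proj₁ u
  ⟨u,e₁⟩ (u₁ , u₂) = solve 2 (λ u v → u :* con (ℤ.+ 1) :+ v :* con (ℤ.+ 0) := u) refl u₁ u₂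

  ⟨u,e₂⟩ : ∀ u → ⟨ u , e₂ ⟩ ≡ proj₂ u
  ⟨u,e₂⟩ (u₁ , u₂) = solve 2 (λ u v → u :* con (ℤ.+ 0) :+ v :* con (ℤ.+ 1) := v) refl u₁ u₂

  ⟨⟩-injective : ∀ {u v} → (∀ d → ⟨ u , d ⟩ ≡ ⟨ v , d ⟩) → u ≡ v
  ⟨⟩-injective {u} {v} u≗v = cong₂ _,_
    (trans (sym (⟨u,e₁⟩ u)) (trans (u≗v e₁) (⟨u,e₁⟩ v)))
    (trans (sym (⟨u,e₂⟩ u)) (trans (u≗v e₂) (⟨u,e₂⟩ v)))

  ⟨⟩-distribʳ : ∀ u v d → ⟨ u -ᵖ v , d ⟩ ≡ ⟨ u , d ⟩ - ⟨ v , d ⟩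
  ⟨⟩-distribʳ (u₁ , u₂) (v₁ , v₂) (d₁ , d₂) = solve 6
    (λ u₁ u₂ v₁ v₂ d₁ d₂ → (u₁ :- v₁) :* d₁ :+ (u₂ :- v₂) :* d₂ := u₁ :* d₁ :+ u₂ :* d₂ :- (v₁ :* d₁ :+ v₂ :* d₂))
    refl u₁ u₂ v₁ v₂ d₁ d₂

  affine-≡ : ∀ {f g} x → gradient f ≡ gradient g → eval f x ≡ eval g x → f ≡ g
  affine-≡ {affine u c} {affine .u d} x refl fx≡gx = cong (affine u) (x-y≡0⇒x≡y (begin
    c - d                                  ≡⟨ solve 3 (λ z c d → c :- d := z :+ c :- (z :+ d)) refl ⟨ u , x ⟩ c d ⟩
    (⟨ u , x ⟩ + c) - (⟨ u , x ⟩ + d)      ≡⟨ x≡y⇒x-y≡0 fx≡gx ⟩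
    0#                                     ∎))
    where open ≡-Reasoning

-- Terms of a tropical polynomial and the regions that they own.

module Tropical (em : ∀ {ℓ} → ExcludedMiddle ℓ) (R : CompleteOrderedField) where
  open CompleteOrderedField R
  open OrderedField em R
  open Extremum em R
  open TropicalPlane R
  open Plane em R
  open Max totalOrder using (x≤x⊔y; x≤y⊔x; ⊔-sel)

  record Active (g : TropicalPolynomial) (ℓ : Affine) (x : Point) : Set where
    constructor active
    field
      term : ℓ ∈ toList g
      top  : ∀ ℓ′ → ℓ′ ∈ toList g → eval ℓ′ x ≤ eval ℓ x

  -- Only competitors different from `ℓ` count, so a term that is repeated in the list can still
  -- dominate.
  record Dominant (g : TropicalPolynomial) (ℓ : Affine) (x : Point) : Set where
    constructor dominant
    field
      term   : ℓ ∈ toList g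
      strict : ∀ ℓ′ → ℓ′ ∈ toList g → ℓ′ ≢ ℓ → eval ℓ′ x < eval ℓ x

  -- These terms correspond to the regions. Other terms may be active, for instance along an edge,
  -- without owning a region.
  Essential : TropicalPolynomial → Pred Affine 0ℓ
  Essential g ℓ = Satisfiable (Dominant g ℓ)

  ≤-value : ∀ ℓ g x → ℓ ∈ toList g → eval ℓ x ≤ ⟦ g ⟧ x
  ≤-value ℓ (_ ∷ [])     x (here refl) = ≤-refl
  ≤-value ℓ (_ ∷ _ ∷ _)  x (here refl) = x≤x⊔y _ _
  ≤-value ℓ (_ ∷ m ∷ ms) x (there ℓ∈)  = ≤-trans (≤-value ℓ (m ∷ ms) x ℓ∈) (x≤y⊔x _ _)

  value-attained′ : ∀ ℓ ms x → ∃ λ ℓ′ → ℓ′ ∈ ℓ ∷ ms × ⟦ ℓ ∷ ms ⟧ x ≡ eval ℓ′ x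
  value-attained′ ℓ []       x = ℓ , here refl , refl
  value-attained′ ℓ (m ∷ ms) x with ⊔-sel (eval ℓ x) (⟦ m ∷ ms ⟧ x)
  ... | inj₁ max≡ = ℓ , here refl , max≡
  ... | inj₂ max≡ = let ℓ′ , ℓ′∈ , val≡ = value-attained′ m ms x in ℓ′ , there ℓ′∈ , trans max≡ val≡

  value-attained : ∀ g x → ∃ λ ℓ → ℓ ∈ toList g × ⟦ g ⟧ x ≡ eval ℓ x
  value-attained (ℓ ∷ ms) = value-attained′ ℓ ms

  active-exists : ∀ g x → ∃ λ ℓ → Active g ℓ x
  active-exists g x = let ℓ , ℓ∈ , val≡ = value-attained g x in
    ℓ , active ℓ∈ λ ℓ′ ℓ′∈ → subst (eval ℓ′ x ≤_) val≡ (≤-value ℓ′ g x ℓ′∈)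

  active-value : ∀ {g ℓ x} → Active g ℓ x → ⟦ g ⟧ x ≡ eval ℓ x
  active-value {g} {ℓ} {x} (active ℓ∈ top) = let ℓ′ , ℓ′∈ , val≡ = value-attained g x in
    ≤-antisym (subst (_≤ eval ℓ x) (sym val≡) (top ℓ′ ℓ′∈)) (≤-value ℓ g x ℓ∈)

  active-≡ : ∀ {g ℓ ℓ′ x} → Active g ℓ x → Active g ℓ′ x → eval ℓ x ≡ eval ℓ′ x
  active-≡ (active ℓ∈ top) (active ℓ′∈ top′) = ≤-antisym (top′ _ ℓ∈) (top _ ℓ′∈)

  dominant⇒active : ∀ {g ℓ x} → Dominant g ℓ x → Active g ℓ x
  dominant⇒active {g} {ℓ} {x} (dominant ℓ∈ strict) = active ℓ∈ top
    where
    top : ∀ ℓ′ → ℓ′ ∈ toList g → eval ℓ′ x ≤ eval ℓ x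
    top ℓ′ ℓ′∈ with em {P = ℓ′ ≡ ℓ}
    ... | yes refl = ≤-refl
    ... | no  ℓ′≢ℓ = <⇒≤ (strict ℓ′ ℓ′∈ ℓ′≢ℓ)

  dominant-unique : ∀ {g ℓ ℓ′ x} → Dominant g ℓ x → Dominant g ℓ′ x → ℓ ≡ ℓ′
  dominant-unique {g} {ℓ} {ℓ′} (dominant ℓ∈ strict) dom′ = decidable-stable em λ ℓ≢ℓ′ →
    <⇒≱ (strict ℓ′ (Dominant.term dom′) (λ ℓ′≡ℓ → ℓ≢ℓ′ (sym ℓ′≡ℓ))) (Active.top (dominant⇒active dom′) ℓ ℓ∈)

  dominant-open : ∀ g ℓ → Open (Dominant g ℓ)
  dominant-open g ℓ x (dominant ℓ∈ strict) = near-mono (dominant ℓ∈)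
    (near-all (toList g) (λ ℓ′ y → ℓ′ ≢ ℓ → eval ℓ′ y < eval ℓ y) each)
    where
    each : ∀ ℓ′ → ℓ′ ∈ toList g → Near x (_⊆ λ y → ℓ′ ≢ ℓ → eval ℓ′ y < eval ℓ y)
    each ℓ′ ℓ′∈ with em {P = ℓ′ ≡ ℓ}
    ... | yes ℓ′≡ℓ = 1# , 0<1 , λ _ ℓ′≢ℓ → contradiction ℓ′≡ℓ ℓ′≢ℓ
    ... | no  ℓ′≢ℓ = near-mono (λ y< _ → y<) (<-near ℓ′ ℓ x (strict ℓ′ ℓ′∈ ℓ′≢ℓ))

  dominant⇒affine : ∀ {g ℓ x} → Dominant g ℓ x → Near x (AffineOn ⟦ g ⟧)
  dominant⇒affine {g} {ℓ} {x} dom = let ε , 0<ε , B⊆ = dominant-open g ℓ x dom in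
    ε , 0<ε , ℓ , λ y y∈B → active-value (dominant⇒active (B⊆ y∈B))

  -- Near `x` the affine function `f` is at least every term and equals each active one at `x`. A
  -- nonnegative affine difference with an interior zero is constant, so every active term is `f`.
  active-unique : ∀ {g x ℓ ℓ′} → Near x (AffineOn ⟦ g ⟧) → Active g ℓ x → Active g ℓ′ x → ℓ ≡ ℓ′
  active-unique {g} {x} {ℓ} {ℓ′} (ε , 0<ε , f , g≗f) act act′ = trans (sym (local ℓ act)) (local ℓ′ act′)
    where
    local : ∀ m → Active g m x → f ≡ m
    local m act-m@(active m∈ _) = affine-≡ x (⟨⟩-injective λ d → x-y≡0⇒x≡y (trans (sym (⟨⟩-distribʳ (gradient f) (gradient m) d))
      (nonNeg⇒constant (f -ᵃ m) x 0<ε nonNeg (trans (eval-ᵃ f m x) (x≡y⇒x-y≡0 fx≡mx)) d))) fx≡mx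
      where
      fx≡mx : eval f x ≡ eval m x
      fx≡mx = trans (sym (g≗f x (ball-center 0<ε))) (active-value act-m)
      nonNeg : ∀ y → Ball x ε y → 0# ≤ eval (f -ᵃ m) y
      nonNeg y y∈B = subst (0# ≤_) (sym (eval-ᵃ f m y)) (≤⇒0≤ (subst (eval m y ≤_) (g≗f y y∈B) (≤-value m g y m∈)))

  unique⇒dominant : ∀ {g ℓ x} → Active g ℓ x → (∀ ℓ′ → Active g ℓ′ x → ℓ′ ≡ ℓ) → Dominant g ℓ x
  unique⇒dominant {g} {ℓ} {x} (active ℓ∈ top) unique = dominant ℓ∈ λ ℓ′ ℓ′∈ ℓ′≢ℓ → top ℓ′ ℓ′∈ ,
    λ same → ℓ′≢ℓ (unique ℓ′ (active ℓ′∈ λ m m∈ → subst (eval m x ≤_) (sym same) (top m m∈)))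

  affine⇒dominant : ∀ g {x} → Near x (AffineOn ⟦ g ⟧) → ∃ λ ℓ → Dominant g ℓ x
  affine⇒dominant g {x} near = let ℓ , act = active-exists g x in
    ℓ , unique⇒dominant act λ ℓ′ act′ → active-unique {g} near act′ act

  Complement : TropicalPolynomial → Pred Point 0ℓ
  Complement g = ∁ (Support (hypersurface g))

  dominant⇒complement : ∀ {g ℓ x} → Dominant g ℓ x → Complement g x
  dominant⇒complement dom singular = singular (dominant⇒affine dom)

  complement⇒dominant : ∀ g {x} → Complement g x → ∃ λ ℓ → Dominant g ℓ x
  complement⇒dominant g x∈ = affine⇒dominant g (decidable-stable em x∈)

  -- The points dominated by `ℓ` and those dominated by other terms form two disjoint open sets that
  -- cover the complement, so a connected part stays in one of them. Consequently there are at most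
  -- as many essential terms as components.
  dominant-component : ∀ g {ℓ x y} → SameComponent (Complement g) x y → Dominant g ℓ x → Dominant g ℓ y
  dominant-component g {ℓ} {x} {y} (S , S⊆ , connected , x∈S , y∈S) dom = unless-other (dichotomy y∈S)
    where
    Other : Pred Point 0ℓ
    Other z = ∃ λ ℓ′ → ℓ′ ≢ ℓ × Dominant g ℓ′ z

    other-open : Open Other
    other-open z (ℓ′ , ℓ′≢ℓ , dom′) = near-mono {P = Dominant g ℓ′} (λ d → ℓ′ , ℓ′≢ℓ , d) (dominant-open g ℓ′ z dom′)

    dominant-or-other : ∀ {z} → (∃ λ ℓ′ → Dominant g ℓ′ z) → Dominant g ℓ z ⊎ Other z
    dominant-or-other (ℓ′ , dom′) with em {P = ℓ′ ≡ ℓ}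
    ... | yes refl = inj₁ dom′
    ... | no ℓ′≢ℓ  = inj₂ (ℓ′ , ℓ′≢ℓ , dom′)

    dichotomy : S ⊆ λ z → Dominant g ℓ z ⊎ Other z
    dichotomy {z} z∈S = dominant-or-other (complement⇒dominant g {z} (S⊆ z∈S))

    disjoint : ¬ Satisfiable (S ∩ (Dominant g ℓ ∩ Other))
    disjoint (_ , _ , dom-z , ℓ′ , ℓ′≢ℓ , dom′-z) = ℓ′≢ℓ (dominant-unique dom′-z dom-z)

    unless-other : Dominant g ℓ y ⊎ Other y → Dominant g ℓ y
    unless-other (inj₁ dom-y) = dom-y
    unless-other (inj₂ other) = contradiction
      (connected (Dominant g ℓ) Other (dominant-open g ℓ) other-open dichotomy (x , x∈S , dom) (y , y∈S , other)) disjoint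

  module _ {g m} (components : NumberOfComponents (Complement g) m) where
    open NumberOfComponents components

    regionIndex : ∀ ℓ → Essential g ℓ → Fin m
    regionIndex ℓ (x , dom) = proj₁ (covers x (dominant⇒complement dom))

    dominant-representative : ∀ {ℓ} (e : Essential g ℓ) → Dominant g ℓ (representative (regionIndex ℓ e))
    dominant-representative (x , dom) = dominant-component g (proj₂ (covers x (dominant⇒complement dom))) dom

    regionIndex-injective : ∀ {ℓ ℓ′} (e : Essential g ℓ) (e′ : Essential g ℓ′) →
                            regionIndex ℓ e ≡ regionIndex ℓ′ e′ → ℓ ≡ ℓ′
    regionIndex-injective {ℓ} {ℓ′} e e′ same = dominant-unique (dominant-representative e)
      (subst (λ i → Dominant g ℓ′ (representative i)) (sym same) (dominant-representative e′))

  slope : Point → Affine → ℝ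
  slope d ℓ = ⟨ gradient ℓ , d ⟩

  Generic : TropicalPolynomial → Point → Set
  Generic g d = ∀ {ℓ ℓ′} → ℓ ∈ toList g → ℓ′ ∈ toList g → slope d ℓ ≡ slope d ℓ′ → gradient ℓ ≡ gradient ℓ′

  -- The steepest active term in a generic direction d is dominant at x + τ d
  -- for all small τ > 0.
  steepest-essential : ∀ {g d} → Generic g d → ∀ x → ∃ λ ℓ → Essential g ℓ × Active g ℓ x ×
                       (∀ ℓ′ → Active g ℓ′ x → slope d ℓ′ ≤ slope d ℓ)
  steepest-essential {g} {d} generic x with maximum-on (slope d) (λ ℓ → Active g ℓ x) (toList g)
  ... | inj₁ none = let ℓ , act = active-exists g x in contradiction act (none ℓ (Active.term act))
  ... | inj₂ (ℓ , ℓ∈ , act , steepest) = ℓ , essential , act , λ ℓ′ act′ → steepest ℓ′ (Active.term act′) act′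
    where
    inactive-near : ∀ ℓ′ → ℓ′ ∈ toList g → Near x (_⊆ λ y → ¬ Active g ℓ′ x → eval ℓ′ y < eval ℓ y)
    inactive-near ℓ′ ℓ′∈ with em {P = Active g ℓ′ x}
    ... | yes act′ = 1# , 0<1 , λ _ ¬act′ → contradiction act′ ¬act′
    ... | no ¬act′ = near-mono (λ y< _ → y<) (<-near ℓ′ ℓ x (Active.top act ℓ′ ℓ′∈ ,
      λ same → ¬act′ (active ℓ′∈ λ m m∈ → subst (eval m x ≤_) (sym same) (Active.top act m m∈))))

    essential : Essential g ℓ
    essential =
      let ε , 0<ε , B⊆ = near-all (toList g) (λ ℓ′ y → ¬ Active g ℓ′ x → eval ℓ′ y < eval ℓ y) inactive-near
          η , 0<η , ray = ball-ray {x} d 0<ε in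
      x +ᵖ η · d , dominant ℓ∈ λ ℓ′ ℓ′∈ ℓ′≢ℓ → dominates η 0<η ℓ′ ℓ′∈ ℓ′≢ℓ (B⊆ (ray η ≤-refl) ℓ′ ℓ′∈) em
      where
      dominates : ∀ η → 0# < η → ∀ ℓ′ → ℓ′ ∈ toList g → ℓ′ ≢ ℓ →
                  (¬ Active g ℓ′ x → eval ℓ′ (x +ᵖ η · d) < eval ℓ (x +ᵖ η · d)) →
                  Dec (Active g ℓ′ x) → eval ℓ′ (x +ᵖ η · d) < eval ℓ (x +ᵖ η · d)
      dominates η 0<η ℓ′ ℓ′∈ ℓ′≢ℓ inactive (no ¬act′) = inactive ¬act′
      dominates η 0<η ℓ′ ℓ′∈ ℓ′≢ℓ inactive (yes act′) =
        subst₂ _<_ (sym (eval-ray ℓ′ x η d)) (sym (eval-ray ℓ x η d))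
          (subst (λ z → z + η * slope d ℓ′ < eval ℓ x + η * slope d ℓ) (active-≡ act act′) (+-monoʳ-< (eval ℓ x) (*-monoʳ-< 0<η slope<)))
        where
        slope< : slope d ℓ′ < slope d ℓ
        slope< = steepest ℓ′ ℓ′∈ act′ , λ same → ℓ′≢ℓ (affine-≡ x (generic ℓ′∈ ℓ∈ same) (active-≡ act′ act))

  slope-scale : ∀ t d ℓ → slope (t · d) ℓ ≡ t * slope d ℓ
  slope-scale t (d₁ , d₂) (affine (u₁ , u₂) _) = solve 5
    (λ t d₁ d₂ u₁ u₂ → u₁ :* (t :* d₁) :+ u₂ :* (t :* d₂) := t :* (u₁ :* d₁ :+ u₂ :* d₂)) refl t d₁ d₂ u₁ u₂

  -1# : ℝ
  -1# = 0# - 1#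

  -1*-cancel : ∀ x → -1# * (-1# * x) ≡ x
  -1*-cancel = solve 1 (λ x → (con (ℤ.+ 0) :- con (ℤ.+ 1)) :* ((con (ℤ.+ 0) :- con (ℤ.+ 1)) :* x) := x) refl

  -1*-antitone : ∀ {x y} → -1# * x ≤ -1# * y → y ≤ x
  -1*-antitone {x} {y} -x≤-y = by-nonNeg (≤⇒0≤ -x≤-y) (solve 2
    (λ x y → (con (ℤ.+ 0) :- con (ℤ.+ 1)) :* y :- (con (ℤ.+ 0) :- con (ℤ.+ 1)) :* x := x :- y) refl x y)

  generic-opposite : ∀ {g d} → Generic g d → Generic g (-1# · d)
  generic-opposite {g} {d} generic {ℓ} {ℓ′} ℓ∈ ℓ′∈ same = generic ℓ∈ ℓ′∈ (begin
    slope d ℓ                   ≡⟨ -1*-cancel (slope d ℓ) ⟨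
    -1# * (-1# * slope d ℓ)     ≡⟨ cong (-1# *_) (slope-scale -1# d ℓ) ⟨
    -1# * slope (-1# · d) ℓ     ≡⟨ cong (-1# *_) same ⟩
    -1# * slope (-1# · d) ℓ′    ≡⟨ cong (-1# *_) (slope-scale -1# d ℓ′) ⟩
    -1# * (-1# * slope d ℓ′)    ≡⟨ -1*-cancel (slope d ℓ′) ⟩
    slope d ℓ′                  ∎)
    where open ≡-Reasoning

  -- At a singular point the steepest and the least steep active terms differ.
  two-essentials : ∀ {g d} → Generic g d → ∀ x → Support (hypersurface g) x →
                   ∃₂ λ ℓ ℓ′ → ℓ ≢ ℓ′ × Essential g ℓ × Essential g ℓ′ × Active g ℓ x × Active g ℓ′ x
  two-essentials {g} {d} generic x singular =
    let ℓ  , ess  , act  , max = steepest-essential {g} {d} generic x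
        ℓ′ , ess′ , act′ , min = steepest-essential {g} {d = -1# · d} (generic-opposite generic) x in
    ℓ , ℓ′ , (λ ℓ≡ℓ′ → singular (regular ℓ act max (subst (λ l → ∀ m → Active g m x → slope (-1# · d) m ≤ slope (-1# · d) l) (sym ℓ≡ℓ′) min)))
      , ess , ess′ , act , act′
    where
    regular : ∀ ℓ → Active g ℓ x → (∀ m → Active g m x → slope d m ≤ slope d ℓ) →
              (∀ m → Active g m x → slope (-1# · d) m ≤ slope (-1# · d) ℓ) → Near x (AffineOn ⟦ g ⟧)
    regular ℓ act max min = dominant⇒affine (unique⇒dominant act unique)
      where
      unique : ∀ m → Active g m x → m ≡ ℓ
      unique m act-m = affine-≡ x (generic (Active.term act-m) (Active.term act) (≤-antisym (max m act-m)
        (-1*-antitone (subst₂ _≤_ (slope-scale -1# d m) (slope-scale -1# d ℓ) (min m act-m))))) (active-≡ act-m act)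

  upper-bound : ∀ xs → ∃ λ b → ∀ x → x ∈ xs → x ≤ b
  upper-bound []       = 0# , λ _ ()
  upper-bound (x ∷ xs) = let b , bound = upper-bound xs in
    x ⊔ b , λ { _ (here refl) → x≤x⊔y x b ; y (there y∈) → ≤-trans (bound y y∈) (x≤y⊔x x b) }

  -- (δ , 1) is orthogonal to (w₁ , w₂) with w₁ ≠ 0 only if δ = - w₂ / w₁.
  non-orthogonal : ∀ ws → ∃ λ δ → ∀ w → w ∈ ws → ⟨ w , (δ , 1#) ⟩ ≡ 0# → w ≡ 0ᵖ
  non-orthogonal ws = b + 1# , λ { w@(w₁ , w₂) w∈ orth → zero-vector w₁ w₂ w∈ orth em }
    where
    root : Point → ℝ
    root (w₁ , w₂) = (0# - w₂) * inv w₁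
    b = proj₁ (upper-bound (map root ws))

    zero-vector : ∀ w₁ w₂ → (w₁ , w₂) ∈ ws → w₁ * (b + 1#) + w₂ * 1# ≡ 0# → Dec (w₁ ≡ 0#) → (w₁ , w₂) ≡ 0ᵖ
    zero-vector w₁ w₂ _ orth (yes refl) = cong (0# ,_) (trans
      (solve 2 (λ w d → w := con (ℤ.+ 0) :* d :+ w :* con (ℤ.+ 1)) refl w₂ (b + 1#)) orth)
    zero-vector w₁ w₂ w∈ orth (no w₁≢0) = contradiction
      (subst (_≤ b) root≡b+1 (proj₂ (upper-bound (map root ws)) (root (w₁ , w₂)) (∈-map⁺ root w∈)))
      (<⇒≱ (by-pos 0<1 (solve 1 (λ b → con (ℤ.+ 1) := b :+ con (ℤ.+ 1) :- b) refl b)))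
      where
      open ≡-Reasoning
      root≡b+1 : root (w₁ , w₂) ≡ b + 1#
      root≡b+1 = x-y≡0⇒x≡y (*-cancel-0 w₁≢0 (begin
        w₁ * ((0# - w₂) * inv w₁ - (b + 1#))          ≡⟨ solve 4 (λ w₁ w₂ i d → w₁ :* ((con (ℤ.+ 0) :- w₂) :* i :- d) :=
                                                           w₂ :* (con (ℤ.+ 1) :- w₁ :* i) :- (w₁ :* d :+ w₂ :* con (ℤ.+ 1))) refl w₁ w₂ (inv w₁) (b + 1#) ⟩
        w₂ * (1# - w₁ * inv w₁) - (w₁ * (b + 1#) + w₂ * 1#) ≡⟨ cong₂ (λ y z → w₂ * (1# - y) - z) (*-inv w₁≢0) orth ⟩
        w₂ * (1# - 1#) - 0#                           ≡⟨ solve 1 (λ w → w :* (con (ℤ.+ 1) :- con (ℤ.+ 1)) :- con (ℤ.+ 0) := con (ℤ.+ 0)) refl w₂ ⟩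
        0#                                            ∎))

  -- It suffices to avoid the directions orthogonal to one of the finitely many nonzero differences
  -- of gradients. The second coordinate 1 makes the direction usable as the axis of a shear.
  generic-exists : ∀ g → ∃ λ δ → Generic g (δ , 1#)
  generic-exists g = δ , λ {ℓ} {ℓ′} ℓ∈ ℓ′∈ same → difference-zero (orth
      (gradient ℓ -ᵖ gradient ℓ′) (∈-map⁺ (λ (ℓ , ℓ′) → gradient ℓ -ᵖ gradient ℓ′) (∈-cartesianProduct⁺ ℓ∈ ℓ′∈))
      (trans (⟨⟩-distribʳ (gradient ℓ) (gradient ℓ′) (δ , 1#)) (x≡y⇒x-y≡0 same)))
    where
    differences : List Point
    differences = map (λ (ℓ , ℓ′) → gradient ℓ -ᵖ gradient ℓ′) (cartesianProduct (toList g) (toList g))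
    δ    = proj₁ (non-orthogonal differences)
    orth = proj₂ (non-orthogonal differences)
    difference-zero : ∀ {u v} → u -ᵖ v ≡ 0ᵖ → u ≡ v
    difference-zero u-v≡0 = cong₂ _,_ (x-y≡0⇒x≡y (cong proj₁ u-v≡0)) (x-y≡0⇒x≡y (cong proj₂ u-v≡0))

-- The pigeonhole principle for lists.

lookup-related : ∀ {A : Set} {_~_ : Rel A 0ℓ} {xs} → AllPairs _~_ xs → ∀ {i j} → i Fin.< j → List.lookup xs i ~ List.lookup xs j
lookup-related (x~xs ∷ _) {zero}  {suc j} _           = All.lookup x~xs (∈-lookup j)
lookup-related (_ ∷ xs~)  {suc i} {suc j} (ℕ.s≤s i<j) = lookup-related xs~ i<j

-- With more positions than slots, two positions would share a slot, although their entries are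
-- unrelated.
length≤ : ∀ {A : Set} {_~_ : Rel A 0ℓ} {P : Pred A 0ℓ} {xs : List A} {n} → AllPairs (λ x y → ¬ x ~ y) xs → All P xs →
          (slot : ∀ {x} → P x → Fin n) → (∀ {x y} (p : P x) (q : P y) → slot p ≡ slot q → x ~ y) → length xs ℕ.≤ n
length≤ {P = P} {xs} {n} unrelated ps slot slot-injective = ℕ.≮⇒≥ λ n<len →
  let i , j , i<j , same = Fin.pigeonhole n<len (λ i → slot (All.lookup ps (∈-lookup i))) in
  lookup-related unrelated i<j (slot-injective (All.lookup ps (∈-lookup i)) (All.lookup ps (∈-lookup j)) same)

-- Lines that carry an edge of one curve.

module Edges (em : ∀ {ℓ} → ExcludedMiddle ℓ) (R : CompleteOrderedField) where
  open CompleteOrderedField R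
  open OrderedField em R
  open Extremum em R
  open TropicalPlane R
  open Plane em R
  open Tropical em R

  cross : Point → Point → ℝ
  cross (v₁ , v₂) (k₁ , k₂) = v₁ * k₂ - v₂ * k₁

  nonzero-cancel : ∀ {w y} → w ≢ 0ᵖ → proj₁ w * y ≡ 0# → proj₂ w * y ≡ 0# → y ≡ 0#
  nonzero-cancel {w₁ , w₂} {y} w≢0 w₁y≡0 w₂y≡0 = decidable-stable em λ y≢0 →
    w≢0 (cong₂ _,_ (*-cancel-0 y≢0 (trans (*-comm y w₁) w₁y≡0)) (*-cancel-0 y≢0 (trans (*-comm y w₂) w₂y≡0)))

  -- Each coordinate of `w` times the determinant is a combination of the two vanishing scalar
  -- products, and some coordinate is nonzero.
  orthogonal⇒parallel : ∀ w v k → w ≢ 0ᵖ → ⟨ w , v ⟩ ≡ 0# → ⟨ w , k ⟩ ≡ 0# → cross v k ≡ 0#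
  orthogonal⇒parallel (w₁ , w₂) (v₁ , v₂) (k₁ , k₂) w≢0 wv≡0 wk≡0 = nonzero-cancel w≢0
    (trans (solve 6 (λ w₁ w₂ v₁ v₂ k₁ k₂ → w₁ :* (v₁ :* k₂ :- v₂ :* k₁) :=
              (w₁ :* v₁ :+ w₂ :* v₂) :* k₂ :- (w₁ :* k₁ :+ w₂ :* k₂) :* v₂) refl w₁ w₂ v₁ v₂ k₁ k₂)
           (vanish k₂ v₂ wv≡0 wk≡0))
    (trans (solve 6 (λ w₁ w₂ v₁ v₂ k₁ k₂ → w₂ :* (v₁ :* k₂ :- v₂ :* k₁) :=
              (w₁ :* k₁ :+ w₂ :* k₂) :* v₁ :- (w₁ :* v₁ :+ w₂ :* v₂) :* k₁) refl w₁ w₂ v₁ v₂ k₁ k₂)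
           (vanish v₁ k₁ wk≡0 wv≡0))
    where
    vanish : ∀ {x y} a b → x ≡ 0# → y ≡ 0# → x * a - y * b ≡ 0#
    vanish a b refl refl = solve 2 (λ a b → con (ℤ.+ 0) :* a :- con (ℤ.+ 0) :* b := con (ℤ.+ 0)) refl a b

  parallel⇒orthogonal : ∀ w v k → v ≢ 0ᵖ → ⟨ w , v ⟩ ≡ 0# → cross v k ≡ 0# → ⟨ w , k ⟩ ≡ 0#
  parallel⇒orthogonal (w₁ , w₂) (v₁ , v₂) (k₁ , k₂) v≢0 wv≡0 vk≡0 = nonzero-cancel v≢0
    (trans (solve 6 (λ w₁ w₂ v₁ v₂ k₁ k₂ → v₁ :* (w₁ :* k₁ :+ w₂ :* k₂) :=
              (w₁ :* v₁ :+ w₂ :* v₂) :* k₁ :+ (v₁ :* k₂ :- v₂ :* k₁) :* w₂) refl w₁ w₂ v₁ v₂ k₁ k₂)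
           (vanish k₁ w₂ wv≡0 vk≡0))
    (trans (solve 6 (λ w₁ w₂ v₁ v₂ k₁ k₂ → v₂ :* (w₁ :* k₁ :+ w₂ :* k₂) :=
              (w₁ :* v₁ :+ w₂ :* v₂) :* k₂ :+ (v₁ :* k₂ :- v₂ :* k₁) :* (con (ℤ.+ 0) :- w₁)) refl w₁ w₂ v₁ v₂ k₁ k₂)
           (vanish k₂ (0# - w₁) wv≡0 vk≡0))
    where
    vanish : ∀ {x y} a b → x ≡ 0# → y ≡ 0# → x * a + y * b ≡ 0#
    vanish a b refl refl = solve 2 (λ a b → con (ℤ.+ 0) :* a :+ con (ℤ.+ 0) :* b := con (ℤ.+ 0)) refl a b

  difference≢0 : ∀ {p q} → p ≢ q → q -ᵖ p ≢ 0ᵖ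
  difference≢0 p≢q q-p≡0 = p≢q (sym (cong₂ _,_ (x-y≡0⇒x≡y (cong proj₁ q-p≡0)) (x-y≡0⇒x≡y (cong proj₂ q-p≡0))))

  zero-step : ∀ f p q → eval f p ≡ 0# → eval f q ≡ 0# → ⟨ gradient f , q -ᵖ p ⟩ ≡ 0#
  zero-step f p q fp≡0 fq≡0 = begin
    ⟨ gradient f , q -ᵖ p ⟩              ≡⟨ +-identityˡ ⟨ gradient f , q -ᵖ p ⟩ ⟨
    0# + ⟨ gradient f , q -ᵖ p ⟩         ≡⟨ cong (_+ ⟨ gradient f , q -ᵖ p ⟩) fp≡0 ⟨
    eval f p + ⟨ gradient f , q -ᵖ p ⟩   ≡⟨ eval-step f p q ⟨
    eval f q                             ≡⟨ fq≡0 ⟩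
    0#                                   ∎
    where open ≡-Reasoning

  -- Both `z - p` and `q - p` are orthogonal to the gradient of `f`, hence parallel, and `f′` does
  -- not change along them.
  same-zeros : ∀ f f′ p q → gradient f ≢ 0ᵖ → p ≢ q → eval f p ≡ 0# → eval f q ≡ 0# →
               eval f′ p ≡ 0# → eval f′ q ≡ 0# → ∀ z → eval f z ≡ 0# → eval f′ z ≡ 0#
  same-zeros f f′ p q u≢0 p≢q fp≡0 fq≡0 f′p≡0 f′q≡0 z fz≡0 = begin
    eval f′ z                              ≡⟨ eval-step f′ p z ⟩
    eval f′ p + ⟨ gradient f′ , z -ᵖ p ⟩   ≡⟨ cong₂ _+_ f′p≡0 (parallel⇒orthogonal (gradient f′) (q -ᵖ p) (z -ᵖ p) (difference≢0 p≢q)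
                                                (zero-step f′ p q f′p≡0 f′q≡0)
                                                (orthogonal⇒parallel (gradient f) (q -ᵖ p) (z -ᵖ p) u≢0 (zero-step f p q fp≡0 fq≡0) (zero-step f p z fp≡0 fz≡0))) ⟩
    0# + 0#                                ≡⟨ +-identityˡ 0# ⟩
    0#                                     ∎
    where open ≡-Reasoning

  -- Two points witness an edge: the set where two given terms are both active is convex, and two of
  -- its points fix the line, which `zeros` and `on-line` identify with `L`.
  record HasEdgeOn (g : TropicalPolynomial) (L : WeightedLine) : Set where
    field
      {ℓ ℓ′}   : Affine
      {p q}    : Point
      ℓ≢ℓ′     : ℓ ≢ ℓ′
      ess      : Essential g ℓ
      ess′     : Essential g ℓ′
      p≢q      : p ≢ q
      p∈L      : Line L p
      q∈L      : Line L q
      active-p  : Active g ℓ p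
      active-q  : Active g ℓ q
      active′-p : Active g ℓ′ p
      active′-q : Active g ℓ′ q

    zeros : ∀ z → Line L z → eval (ℓ -ᵃ ℓ′) z ≡ 0#
    zeros = same-zeros (WeightedLine.equation L) (ℓ -ᵃ ℓ′) p q (WeightedLine.gradient≢0 L) p≢q p∈L q∈L
      (trans (eval-ᵃ ℓ ℓ′ p) (x≡y⇒x-y≡0 (active-≡ active-p active′-p)))
      (trans (eval-ᵃ ℓ ℓ′ q) (x≡y⇒x-y≡0 (active-≡ active-q active′-q)))

    on-line : ∀ z → eval (ℓ -ᵃ ℓ′) z ≡ 0# → Line L z
    on-line = same-zeros (ℓ -ᵃ ℓ′) (WeightedLine.equation L) p q
      (λ u-u′≡0 → ℓ≢ℓ′ (affine-≡ p (cong₂ _,_ (x-y≡0⇒x≡y (cong proj₁ u-u′≡0)) (x-y≡0⇒x≡y (cong proj₂ u-u′≡0))) (active-≡ active-p active′-p)))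
      p≢q
      (trans (eval-ᵃ ℓ ℓ′ p) (x≡y⇒x-y≡0 (active-≡ active-p active′-p)))
      (trans (eval-ᵃ ℓ ℓ′ q) (x≡y⇒x-y≡0 (active-≡ active-q active′-q)))
      p∈L q∈L

    equal-on : ∀ z → Line L z → eval ℓ z ≡ eval ℓ′ z
    equal-on z z∈L = x-y≡0⇒x≡y (trans (sym (eval-ᵃ ℓ ℓ′ z)) (zeros z z∈L))

    equal⇒on : ∀ z → eval ℓ z ≡ eval ℓ′ z → Line L z
    equal⇒on z same = on-line z (trans (eval-ᵃ ℓ ℓ′ z) (x≡y⇒x-y≡0 same))

  module _ (g : TropicalPolynomial) where
    private
      δ : ℝ
      δ = proj₁ (generic-exists g)

      d : Point
      d = δ , 1#

      generic : Generic g d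
      generic = proj₂ (generic-exists g)

    -- For a point written as `h · e₁ +ᵖ t · d`, the value of a term has the coefficient
    -- `proj₁ (gradient ℓ)` at `h` and `slope d ℓ` at `t`.
    open UpperEnvelope em R Affine (λ ℓ → proj₁ (gradient ℓ)) (slope d) const (toList g) (Essential g)
      hiding (Active)

    -- Coordinates in which d is the vertical direction.
    horizontal vertical : Point → ℝ
    horizontal (x₁ , x₂) = x₁ - x₂ * δ
    vertical   (x₁ , x₂) = x₂

    val-eval : ∀ ℓ x → val ℓ (horizontal x) (vertical x) ≡ eval ℓ x
    val-eval (affine (u₁ , u₂) c) (x₁ , x₂) = solve 6 (λ u₁ u₂ c x₁ x₂ δ →
      u₁ :* (x₁ :- x₂ :* δ) :+ (u₁ :* δ :+ u₂ :* con (ℤ.+ 1)) :* x₂ :+ c := u₁ :* x₁ :+ u₂ :* x₂ :+ c) refl u₁ u₂ c x₁ x₂ δ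

    essential-term : ∀ ℓ → Essential g ℓ → ℓ ∈ toList g
    essential-term ℓ (_ , dom) = Dominant.term dom

    -- Equal slopes in a generic direction mean equal gradients, and two different parallel terms
    -- that both dominate somewhere would each need the larger constant.
    slope-injective : ∀ {ℓ ℓ′} → Essential g ℓ → Essential g ℓ′ → slope d ℓ ≡ slope d ℓ′ → ℓ ≡ ℓ′
    slope-injective {ℓ} {ℓ′} (x , dom) (x′ , dom′) same = decidable-stable em λ ℓ≢ℓ′ →
      <-irrefl (<-trans (consts ℓ ℓ′ x u≡u′ (Dominant.strict dom ℓ′ (Dominant.term dom′) λ ℓ′≡ℓ → ℓ≢ℓ′ (sym ℓ′≡ℓ)))
                        (consts ℓ′ ℓ x′ (sym u≡u′) (Dominant.strict dom′ ℓ (Dominant.term dom) ℓ≢ℓ′)))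
      where
      u≡u′ : gradient ℓ ≡ gradient ℓ′
      u≡u′ = generic (Dominant.term dom) (Dominant.term dom′) same
      consts : ∀ ℓ ℓ′ x → gradient ℓ ≡ gradient ℓ′ → eval ℓ′ x < eval ℓ x → const ℓ′ < const ℓ
      consts (affine u c) (affine .u c′) x refl ℓ′<ℓ = by-pos (<⇒0< ℓ′<ℓ)
        (solve 3 (λ z c c′ → z :+ c :- (z :+ c′) := c :- c′) refl ⟨ u , x ⟩ c c′)

    exposed : ∀ ℓ → Essential g ℓ → Exposed ℓ
    exposed ℓ (x , dom) = horizontal x , vertical x , λ ℓ′ ess′ ℓ′≢ℓ →
      subst₂ _<_ (sym (val-eval ℓ′ x)) (sym (val-eval ℓ x)) (Dominant.strict dom ℓ′ (essential-term ℓ′ ess′) ℓ′≢ℓ)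

    meet : ∀ {a b} x → Active g a x → Active g b x → val a (horizontal x) (vertical x) ≡ val b (horizontal x) (vertical x)
    meet {a} {b} x a-x b-x = trans (val-eval a x) (trans (active-≡ a-x b-x) (sym (val-eval b x)))

    edge : ∀ {a b} p q → Essential g a → Essential g b → slope d a < slope d b → Active g a p → Active g b p →
           Active g a q → Active g b q → horizontal p < horizontal q → Edge a b
    edge {a} {b} p q ess-a ess-b a<b a-p b-p a-q b-q p<q = record
      { a∈E = ess-a ; b∈E = ess-b ; a<b = a<b
      ; h₁ = horizontal p ; h₂ = horizontal q ; t₁ = vertical p ; t₂ = vertical q ; h₁<h₂ = p<q
      ; meet₁ = meet p a-p b-p ; meet₂ = meet q a-q b-q ; top₁ = top p a-p ; top₂ = top q a-q }
      where
      top : ∀ x → Active g a x → ∀ ℓ → Essential g ℓ → val ℓ (horizontal x) (vertical x) ≤ val a (horizontal x) (vertical x)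
      top x a-x ℓ ess = subst₂ _≤_ (sym (val-eval ℓ x)) (sym (val-eval a x)) (Active.top a-x ℓ (essential-term ℓ ess))

    crossing-unique : ∀ {a b h t t′} → slope d a < slope d b → val a h t ≡ val b h t → val a h t′ ≡ val b h t′ → t ≡ t′
    crossing-unique {a} {b} {h} {t} {t′} a<b meet meet′ with cmp t t′
    ... | lt t<t′ = contradiction meet′ (proj₂ (right-< {b} {a} {h} a<b t<t′ (≤-reflexive meet)))
    ... | gt t′<t = contradiction meet (proj₂ (right-< {b} {a} {h} a<b t′<t (≤-reflexive meet′)))
    ... | eq t≡t′ = t≡t′

    coordinates-injective : ∀ p q → horizontal p ≡ horizontal q → vertical p ≡ vertical q → p ≡ q
    coordinates-injective (p₁ , p₂) (q₁ , .p₂) same refl = cong (_, p₂)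
      (trans (sym (x-y+y≡x p₁ (p₂ * δ))) (trans (cong (_+ p₂ * δ) same) (x-y+y≡x q₁ (p₂ * δ))))

    -- No edge is vertical, since terms of different slopes tie at most once on a vertical line.
    -- Thus two different points of an edge span a genuine interval of abscissae.
    same-position : ∀ {a b} p q → slope d a < slope d b → Active g a p → Active g b p → Active g a q → Active g b q →
                    horizontal p ≡ horizontal q → p ≡ q
    same-position {a} {b} p q a<b a-p b-p a-q b-q same = coordinates-injective p q same
      (crossing-unique {a} {b} a<b (meet p a-p b-p)
        (subst (λ h → val a h (vertical q) ≡ val b h (vertical q)) (sym same) (meet q a-q b-q)))

    -- The pair `a`, `b` determines the line as the set where they tie, which carries injectivity
    -- over from edges to lines.
    EdgeAlong : WeightedLine → Affine → Affine → Set
    EdgeAlong L a b = Edge a b × (∀ z → Line L z → eval a z ≡ eval b z) × (∀ z → eval a z ≡ eval b z → Line L z)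

    edge-along : ∀ {L} → HasEdgeOn g L → ∃₂ (EdgeAlong L)
    edge-along {L} e with cmp (slope d (HasEdgeOn.ℓ e)) (slope d (HasEdgeOn.ℓ′ e))
    ... | eq same = contradiction (slope-injective (HasEdgeOn.ess e) (HasEdgeOn.ess′ e) same) (HasEdgeOn.ℓ≢ℓ′ e)
    ... | lt ℓ<ℓ′ = ℓ , ℓ′ , oriented , equal-on , equal⇒on
      where
      open HasEdgeOn e
      oriented : Edge ℓ ℓ′
      oriented with cmp (horizontal p) (horizontal q)
      ... | lt p<q = edge p q ess ess′ ℓ<ℓ′ active-p active′-p active-q active′-q p<q
      ... | gt q<p = edge q p ess ess′ ℓ<ℓ′ active-q active′-q active-p active′-p q<p
      ... | eq p~q = contradiction (same-position p q ℓ<ℓ′ active-p active′-p active-q active′-q p~q) p≢q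
    ... | gt ℓ′<ℓ = ℓ′ , ℓ , oriented , (λ z z∈L → sym (equal-on z z∈L)) , λ z same → equal⇒on z (sym same)
      where
      open HasEdgeOn e
      oriented : Edge ℓ′ ℓ
      oriented with cmp (horizontal p) (horizontal q)
      ... | lt p<q = edge p q ess′ ess ℓ′<ℓ active′-p active-p active′-q active-q p<q
      ... | gt q<p = edge q p ess′ ess ℓ′<ℓ active′-q active-q active′-p active-p q<p
      ... | eq p~q = contradiction (same-position p q ℓ′<ℓ active′-p active-p active′-q active-q p~q) p≢q

    some-essential : ∃ λ ℓ → Essential g ℓ
    some-essential = let ℓ , ess , _ = steepest-essential {g} {d} generic 0ᵖ in ℓ , ess

    maximal-essential : (f : Affine → ℝ) → ∃ λ m → Essential g m × (∀ ℓ → Essential g ℓ → f ℓ ≤ f m)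
    maximal-essential f = conclude (maximum-on f (Essential g) (toList g))
      where
      conclude : (∀ ℓ → ℓ ∈ toList g → ¬ Essential g ℓ) ⊎
                 (∃ λ m → m ∈ toList g × Essential g m × (∀ ℓ → ℓ ∈ toList g → Essential g ℓ → f ℓ ≤ f m)) →
                 ∃ λ m → Essential g m × (∀ ℓ → Essential g ℓ → f ℓ ≤ f m)
      conclude (inj₁ none) = let ℓ , ess = some-essential in contradiction ess (none ℓ (essential-term ℓ ess))
      conclude (inj₂ (m , _ , ess , max)) = m , ess , λ ℓ ess′ → max ℓ (essential-term ℓ ess′) ess′

    module LineSlots {n} (components : MComp (hypersurface g) (suc n)) where
      highest = maximal-essential (slope d)
      lowest  = maximal-essential (λ ℓ → 0# - slope d ℓ)

      neg-antitone : ∀ {x y} → 0# - x ≤ 0# - y → y ≤ x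
      neg-antitone {x} {y} -x≤-y = by-nonNeg (≤⇒0≤ -x≤-y)
        (solve 2 (λ x y → con (ℤ.+ 0) :- y :- (con (ℤ.+ 0) :- x) := x :- y) refl x y)

      open EdgeSlots essential-term slope-injective exposed (regionIndex {g} components) (regionIndex-injective {g} components)
        (proj₁ (proj₂ lowest)) (λ ℓ ess → neg-antitone (proj₂ (proj₂ lowest) ℓ ess))
        (proj₁ (proj₂ highest)) (proj₂ (proj₂ highest))

      lineSlot : ∀ {L} → ∃₂ (EdgeAlong L) → Fin (3 ℕ.* n)
      lineSlot (_ , _ , e , _) = edgeSlot e

      lineSlot-injective : ∀ {L M} (e : ∃₂ (EdgeAlong L)) (f : ∃₂ (EdgeAlong M)) → lineSlot {L} e ≡ lineSlot {M} f → Line L ≐ Line M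
      lineSlot-injective {L} {M} (a , b , e , on , off) (a′ , b′ , e′ , on′ , off′) same = same-line (edgeSlot-injective e e′ same)
        where
        same-line : a ≡ a′ × b ≡ b′ → Line L ≐ Line M
        same-line (refl , refl) = (λ {z} z∈L → off′ z (on z z∈L)) , (λ {z} z∈M → off z (on′ z z∈M))

    -- This form avoids truncated subtraction in 3 (m - 1); `m` is positive because some essential
    -- term owns a component.
    lines-bound : ∀ {m Ls} → MComp (hypersurface g) m → AllPairs (λ L M → ¬ (Line L ≐ Line M)) Ls → All (HasEdgeOn g) Ls →
                  length Ls ℕ.+ 3 ℕ.≤ 3 ℕ.* m
    lines-bound {ℕ.zero} components _ _ =
      let ℓ , ess = some-essential in contradiction (regionIndex {g} components ℓ ess) λ ()
    lines-bound {suc n} {Ls} components distinct edges =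
      subst (length Ls ℕ.+ 3 ℕ.≤_) (trans (ℕ.+-comm (3 ℕ.* n) 3) (sym (ℕ.*-suc 3 n)))
        (ℕ.+-monoˡ-≤ 3 (length≤ {_~_ = λ L M → Line L ≐ Line M} {P = λ L → ∃₂ (EdgeAlong L)} distinct (All.map (λ {L} → edge-along {L}) edges)
          (λ {L} → lineSlot {L}) (λ {L} {M} → lineSlot-injective {L} {M})))
      where open LineSlots components

-- Half-planes and the complement of a line.

module HalfPlanes (em : ∀ {ℓ} → ExcludedMiddle ℓ) (R : CompleteOrderedField) where
  open CompleteOrderedField R
  open OrderedField em R
  open TropicalPlane R
  open Plane em R

  HalfPlane : Affine → Pred Point 0ℓ
  HalfPlane f z = 0# < eval f z

  module Path (x y : Point) where
    path : ℝ → Point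
    path t = x +ᵖ t · (y -ᵖ x)

    path-0 : path 0# ≡ x
    path-0 = cong₂ _,_ (start (proj₁ x) (proj₁ y)) (start (proj₂ x) (proj₂ y))
      where
      start : ∀ x y → x + 0# * (y - x) ≡ x
      start = solve 2 (λ x y → x :+ con (ℤ.+ 0) :* (y :- x) := x) refl

    path-1 : path 1# ≡ y
    path-1 = cong₂ _,_ (end (proj₁ x) (proj₁ y)) (end (proj₂ x) (proj₂ y))
      where
      end : ∀ x y → x + 1# * (y - x) ≡ y
      end = solve 2 (λ x y → x :+ con (ℤ.+ 1) :* (y :- x) := y) refl

    path-+ : ∀ s τ → path s +ᵖ τ · (y -ᵖ x) ≡ path (s + τ)
    path-+ s τ = cong₂ _,_ (add (proj₁ x) (proj₁ y - proj₁ x)) (add (proj₂ x) (proj₂ y - proj₂ x))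
      where
      add : ∀ x v → x + s * v + τ * v ≡ x + (s + τ) * v
      add x v = solve 4 (λ x v s t → x :+ s :* v :+ t :* v := x :+ (s :+ t) :* v) refl x v s τ

    path-halfPlane : ∀ f t → HalfPlane f x → HalfPlane f y → 0# ≤ t → t ≤ 1# → HalfPlane f (path t)
    path-halfPlane f t 0<fx 0<fy 0≤t t≤1 = subst (0# <_) (sym interpolate) (positive (≤-or-> t 0#))
      where
      positive : t ≤ 0# ⊎ 0# < t → 0# < (1# - t) * eval f x + t * eval f y
      positive (inj₂ 0<t) = +-nonNeg-pos (*-nonNeg (≤⇒0≤ t≤1) (<⇒≤ 0<fx)) (*-pos 0<t 0<fy)
      positive (inj₁ t≤0) = subst (λ t → 0# < (1# - t) * eval f x + t * eval f y) (≤-antisym 0≤t t≤0)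
        (subst (0# <_) (solve 2 (λ a b → a := (con (ℤ.+ 1) :- con (ℤ.+ 0)) :* a :+ con (ℤ.+ 0) :* b) refl (eval f x) (eval f y)) 0<fx)
      interpolate : eval f (path t) ≡ (1# - t) * eval f x + t * eval f y
      interpolate = begin
        eval f (path t)                                        ≡⟨ eval-ray f x t (y -ᵖ x) ⟩
        eval f x + t * ⟨ gradient f , y -ᵖ x ⟩                 ≡⟨ solve 3 (λ a t b → a :+ t :* b := (con (ℤ.+ 1) :- t) :* a :+ t :* (a :+ b)) refl (eval f x) t ⟨ gradient f , y -ᵖ x ⟩ ⟩
        (1# - t) * eval f x + t * (eval f x + ⟨ gradient f , y -ᵖ x ⟩) ≡⟨ cong (λ z → (1# - t) * eval f x + t * z) (eval-step f x y) ⟨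
        (1# - t) * eval f x + t * eval f y                     ∎
        where open ≡-Reasoning

    open-along : ∀ {U} s → Open U → U (path s) → ∃ λ η → 0# < η × (∀ τ → τ * τ ≤ η * η → U (path (s + τ)))
    open-along {U} s open-U s∈U =
      let ε , 0<ε , B⊆U = open-U (path s) s∈U
          η , 0<η , ray = ball-ray {path s} (y -ᵖ x) 0<ε in
      η , 0<η , λ τ τ²≤η² → subst U (path-+ s τ) (B⊆U (ray τ τ²≤η²))

    -- The supremum s of the parameters whose points lie in U can be in neither
    -- of the open sets U and V if these are disjoint.
    path-connected : ∀ {S U V : Pred Point 0ℓ} → (∀ t → 0# ≤ t → t ≤ 1# → S (path t)) → Open U → Open V → S ⊆ U ∪ V →
                     U x → V y → Satisfiable (S ∩ (U ∩ V))
    path-connected {S} {U} {V} inside open-U open-V cover x∈U y∈V = decidable-stable em λ disjoint →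
      let s , bound , least = supremum Param (0# , 0∈Param) (1# , λ t (_ , t≤1 , _) → t≤1) in
      absurd disjoint s bound least (cover {path s} (inside s (bound 0# 0∈Param) (least 1# λ t (_ , t≤1 , _) → t≤1)))
      where
      Param : Pred ℝ 0ℓ
      Param t = 0# ≤ t × t ≤ 1# × U (path t)

      0∈Param : Param 0#
      0∈Param = ≤-refl , 0≤1 , subst U (sym path-0) x∈U

      module _ (disjoint : ¬ Satisfiable (S ∩ (U ∩ V))) (s : ℝ) (bound : UpperBound Param s)
               (least : ∀ b → UpperBound Param b → s ≤ b) where
        0≤s : 0# ≤ s
        0≤s = bound 0# 0∈Param

        s≤1 : s ≤ 1#
        s≤1 = least 1# λ t (_ , t≤1 , _) → t≤1

        not-in-U : ¬ U (path s)
        not-in-U s∈U with cmp s 1#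
        ... | gt 1<s = <⇒≱ 1<s s≤1
        ... | eq s≡1 = disjoint (y , subst S path-1 (inside 1# 0≤1 ≤-refl) , subst U (trans (cong path s≡1) path-1) s∈U , y∈V)
        ... | lt s<1 =
          let η , 0<η , nearby = open-along s open-U s∈U
              τ , 0<τ , τ≤η , τ≤1-s = smaller 0<η (<⇒0< s<1) in
          <⇒≱ (by-pos 0<τ (solve 2 (λ s t → t := s :+ t :- s) refl s τ))
            (bound (s + τ) (+-nonNeg 0≤s (<⇒≤ 0<τ)
              , by-nonNeg (≤⇒0≤ τ≤1-s) (solve 2 (λ s t → con (ℤ.+ 1) :- s :- t := con (ℤ.+ 1) :- (s :+ t)) refl s τ)
              , nearby τ (square-mono (<⇒≤ 0<τ) τ≤η)))

        not-in-V : ¬ V (path s)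
        not-in-V s∈V =
          let η , 0<η , nearby = open-along s open-V s∈V in
          <⇒≱ (by-pos 0<η (solve 2 (λ s e → e := s :- (s :- e)) refl s η))
            (least (s - η) λ t t∈@(0≤t , t≤1 , Ut) → ≮⇒≥ λ s-η<t →
              disjoint (path t , inside t 0≤t t≤1 , Ut , subst (λ z → V (path z)) (s+t-s s t)
                (nearby (t - s) (subst (_≤ η * η) (swap s t) (square-mono (≤⇒0≤ (bound t t∈))
                  (by-nonNeg (<⇒≤ (<⇒0< s-η<t)) (solve 3 (λ s t e → t :- (s :- e) := e :- (s :- t)) refl s t η)))))))
          where
          s+t-s : ∀ s t → s + (t - s) ≡ t
          s+t-s = solve 2 (λ s t → s :+ (t :- s) := t) refl
          swap : ∀ s t → (s - t) * (s - t) ≡ (t - s) * (t - s)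
          swap = solve 2 (λ s t → (s :- t) :* (s :- t) := (t :- s) :* (t :- s)) refl

        absurd : (U ∪ V) (path s) → ⊥
        absurd (inj₁ s∈U) = not-in-U s∈U
        absurd (inj₂ s∈V) = not-in-V s∈V

  halfPlane-connected : ∀ f → Connected (HalfPlane f)
  halfPlane-connected f U V open-U open-V cover (x , 0<fx , x∈U) (y , 0<fy , y∈V) =
    path-connected {HalfPlane f} {U} {V} (λ t → path-halfPlane f t 0<fx 0<fy) open-U open-V cover x∈U y∈V
    where open Path x y

  -- Both sides of the line are half-planes and so connected; among three representatives two would
  -- lie on the same side.
  line-components : ∀ {L m} → MComp (lineComplex L) m → m ℕ.≤ 2
  line-components {L} {m} components = ℕ.≮⇒≥ λ 2<m →
    let i , j , i<j , same = Fin.pigeonhole 2<m (λ i → side-index (sides i)) in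
    Fin.<⇒≢ i<j (distinct i j (same-side i j (sides i) (sides j) same))
    where
    open NumberOfComponents components
    f = WeightedLine.equation L

    -f : Affine
    -f = affine 0ᵖ 0# -ᵃ f

    eval-neg : ∀ z → eval -f z ≡ 0# - eval f z
    eval-neg z = trans (eval-ᵃ (affine 0ᵖ 0#) f z) (cong (_- eval f z) (vanish (proj₁ z) (proj₂ z)))
      where
      vanish : ∀ z₁ z₂ → 0# * z₁ + 0# * z₂ + 0# ≡ 0#
      vanish = solve 2 (λ x y → con (ℤ.+ 0) :* x :+ con (ℤ.+ 0) :* y :+ con (ℤ.+ 0) := con (ℤ.+ 0)) refl

    sides : ∀ i → HalfPlane f (representative i) ⊎ HalfPlane -f (representative i)
    sides i with cmp 0# (eval f (representative i))
    ... | lt 0<f = inj₁ 0<f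
    ... | eq 0≡f = contradiction (sym 0≡f) (representative∈A i)
    ... | gt f<0 = inj₂ (subst (0# <_) (sym (eval-neg (representative i))) (<⇒0< f<0))

    side-index : ∀ {A B : Set} → A ⊎ B → Fin 2
    side-index (inj₁ _) = zero
    side-index (inj₂ _) = suc zero

    same-side : ∀ i j (p : HalfPlane f (representative i) ⊎ HalfPlane -f (representative i))
                (q : HalfPlane f (representative j) ⊎ HalfPlane -f (representative j)) → side-index p ≡ side-index q →
                SameComponent (∁ (Line L)) (representative i) (representative j)
    same-side i j (inj₁ p) (inj₁ q) _ =
      HalfPlane f , (λ {z} 0<fz fz≡0 → proj₂ 0<fz (sym fz≡0)) , halfPlane-connected f , p , q
    same-side i j (inj₂ p) (inj₂ q) _ =
      HalfPlane -f , (λ {z} 0<-fz fz≡0 → proj₂ 0<-fz (sym (trans (eval-neg z) (x≡y⇒x-y≡0 (sym fz≡0))))) , halfPlane-connected -f , p , q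

-- Counting and integer arithmetic.

repeated-value : ∀ {A : Set} (xs : List A) (W : ℕ → A → Set) → (∀ n → Any (W n) xs) →
                 ∃₂ λ i j → i ℕ.< j × ∃ λ x → W i x × W j x
repeated-value xs W found =
  let i , j , i<j , same = Fin.pigeonhole (ℕ.n<1+n (length xs)) (λ i → Any.index (found (toℕ i))) in
  toℕ i , toℕ j , i<j , List.lookup xs (Any.index (found (toℕ i))) , Any.lookup-index (found (toℕ i)) ,
  subst (λ k → W (toℕ j) (List.lookup xs k)) (sym same) (Any.lookup-index (found (toℕ j)))

length-split : ∀ {A : Set} {P : Pred A 0ℓ} (P? : Decidable P) xs →
               length xs ≡ length (filter P? xs) ℕ.+ length (filter (∁? P?) xs)
length-split P? []       = refl
length-split P? (x ∷ xs) with P? x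
... | yes _ = cong suc (length-split P? xs)
... | no  _ = trans (cong suc (length-split P? xs)) (sym (ℕ.+-suc _ _))

-- `A` counts the components of the complements of the `N` lines, `M` those of the `n` summands. The
-- right side exceeds the left by the slacks `p` and `q` of the hypotheses plus 2, which is 3 from
-- the right constant less 1 from the left.
arrangement-bound : ∀ {N n A M} → A ℕ.≤ 2 ℕ.* N → N ℕ.+ 3 ℕ.* n ℕ.≤ 3 ℕ.* M →
                    (+ A) ℤ.- ((+ N) ℤ.- ℤ.1ℤ) ℤ.≤ + 3 ℤ.* ((+ M) ℤ.- ((+ n) ℤ.- ℤ.1ℤ))
arrangement-bound {N} {n} {A} {M} A≤2N N+3n≤3M = ℤ.0≤i-j⇒j≤i (subst (ℤ.0ℤ ℤ.≤_) difference (ℤ.+≤+ ℕ.z≤n))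
  where
  p = 2 ℕ.* N ℕ.∸ A
  q = 3 ℕ.* M ℕ.∸ (N ℕ.+ 3 ℕ.* n)
  open ≡-Reasoning
  A+p : + A ℤ.+ + p ≡ + 2 ℤ.* + N
  A+p = trans (cong +_ (ℕ.m+[n∸m]≡n A≤2N)) (ℤ.pos-* 2 N)
  N+3n+q : + N ℤ.+ + 3 ℤ.* + n ℤ.+ + q ≡ + 3 ℤ.* + M
  N+3n+q = trans (cong (λ z → + N ℤ.+ z ℤ.+ + q) (sym (ℤ.pos-* 3 n)))
             (trans (cong +_ (ℕ.m+[n∸m]≡n N+3n≤3M)) (ℤ.pos-* 3 M))
  difference : + (p ℕ.+ q ℕ.+ 2) ≡ + 3 ℤ.* ((+ M) ℤ.- ((+ n) ℤ.- ℤ.1ℤ)) ℤ.- ((+ A) ℤ.- ((+ N) ℤ.- ℤ.1ℤ))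
  difference = begin
    + p ℤ.+ + q ℤ.+ + 2
      ≡⟨ solve 5 (λ a n k p q → p :+ q :+ con (+ 2) :=
           (a :+ p) :- con (+ 2) :* n :+ (n :+ con (+ 3) :* k :+ q) :- con (+ 3) :* (k :- con (+ 1)) :- (a :- (n :- con (+ 1)))) refl (+ A) (+ N) (+ n) (+ p) (+ q) ⟩
    (+ A ℤ.+ + p) ℤ.- + 2 ℤ.* + N ℤ.+ (+ N ℤ.+ + 3 ℤ.* + n ℤ.+ + q) ℤ.- + 3 ℤ.* ((+ n) ℤ.- ℤ.1ℤ) ℤ.- ((+ A) ℤ.- ((+ N) ℤ.- ℤ.1ℤ))
      ≡⟨ cong₂ (λ y z → y ℤ.- + 2 ℤ.* + N ℤ.+ z ℤ.- + 3 ℤ.* ((+ n) ℤ.- ℤ.1ℤ) ℤ.- ((+ A) ℤ.- ((+ N) ℤ.- ℤ.1ℤ))) A+p N+3n+q ⟩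
    + 2 ℤ.* + N ℤ.- + 2 ℤ.* + N ℤ.+ + 3 ℤ.* + M ℤ.- + 3 ℤ.* ((+ n) ℤ.- ℤ.1ℤ) ℤ.- ((+ A) ℤ.- ((+ N) ℤ.- ℤ.1ℤ))
      ≡⟨ solve 4 (λ a n k m → con (+ 2) :* n :- con (+ 2) :* n :+ con (+ 3) :* m :- con (+ 3) :* (k :- con (+ 1)) :- (a :- (n :- con (+ 1))) :=
           con (+ 3) :* (m :- (k :- con (+ 1))) :- (a :- (n :- con (+ 1)))) refl (+ A) (+ N) (+ n) (+ M) ⟩
    + 3 ℤ.* ((+ M) ℤ.- ((+ n) ℤ.- ℤ.1ℤ)) ℤ.- ((+ A) ℤ.- ((+ N) ℤ.- ℤ.1ℤ)) ∎
    where open ℤ.+-*-Solver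

add-bounds : ∀ {a b n m s} → a ℕ.+ 3 ℕ.≤ 3 ℕ.* m → b ℕ.+ 3 ℕ.* n ℕ.≤ 3 ℕ.* s →
             (a ℕ.+ b) ℕ.+ 3 ℕ.* suc n ℕ.≤ 3 ℕ.* (m ℕ.+ s)
add-bounds {a} {b} {n} {m} {s} a≤ b≤ = begin
  (a ℕ.+ b) ℕ.+ 3 ℕ.* suc n      ≡⟨ solve 3 (λ a b n → a :+ b :+ con 3 :* (con 1 :+ n) := a :+ con 3 :+ (b :+ con 3 :* n)) refl a b n ⟩
  a ℕ.+ 3 ℕ.+ (b ℕ.+ 3 ℕ.* n)    ≤⟨ ℕ.+-mono-≤ a≤ b≤ ⟩
  3 ℕ.* m ℕ.+ 3 ℕ.* s            ≡⟨ ℕ.*-distribˡ-+ 3 m s ⟨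
  3 ℕ.* (m ℕ.+ s)                ∎
  where
  open ℕ.≤-Reasoning
  open ℕ.+-*-Solver using (solve; con; _:+_; _:*_; _:=_)

-- Faces of the complex, lines of its arrangement, and the final inequality.

module Faces (em : ∀ {ℓ} → ExcludedMiddle ℓ) (R : CompleteOrderedField) where
  open CompleteOrderedField R
  open OrderedField em R
  open TropicalPlane R
  open Plane em R
  open Tropical em R
  open Edges em R
  open HalfPlanes em R

  same-directional : ∀ a b x τ d → τ ≢ 0# → eval a x ≡ eval b x → eval a (x +ᵖ τ · d) ≡ eval b (x +ᵖ τ · d) →
                     ⟨ gradient a , d ⟩ ≡ ⟨ gradient b , d ⟩
  same-directional a b x τ d τ≢0 at-x at-y = x-y≡0⇒x≡y (*-cancel-0 τ≢0 (begin
    τ * (⟨ gradient a , d ⟩ - ⟨ gradient b , d ⟩)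
      ≡⟨ solve 4 (λ t z p q → t :* (p :- q) := z :+ t :* p :- (z :+ t :* q)) refl τ (eval b x) ⟨ gradient a , d ⟩ ⟨ gradient b , d ⟩ ⟩
    (eval b x + τ * ⟨ gradient a , d ⟩) - (eval b x + τ * ⟨ gradient b , d ⟩)
      ≡⟨ cong (λ z → (z + τ * ⟨ gradient a , d ⟩) - (eval b x + τ * ⟨ gradient b , d ⟩)) at-x ⟨
    (eval a x + τ * ⟨ gradient a , d ⟩) - (eval b x + τ * ⟨ gradient b , d ⟩)
      ≡⟨ cong₂ _-_ (eval-ray a x τ d) (eval-ray b x τ d) ⟨
    eval a (x +ᵖ τ · d) - eval b (x +ᵖ τ · d)
      ≡⟨ x≡y⇒x-y≡0 at-y ⟩
    0# ∎))
    where open ≡-Reasoning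

  side-at : ∀ σ t → side σ (Segment.at σ t) ≡ 0#
  side-at record { p = p₁ , p₂ ; q = q₁ , q₂ } t = solve 5 (λ p₁ p₂ q₁ q₂ t →
    (q₁ :- p₁) :* (p₂ :+ t :* (q₂ :- p₂) :- p₂) :- (q₂ :- p₂) :* (p₁ :+ t :* (q₁ :- p₁) :- p₁) := con (ℤ.+ 0)) refl p₁ p₂ q₁ q₂ t

  -- An affine function is odd about each of its zeros.
  side-opposite : ∀ σ x τ d → side σ x ≡ 0# → side σ (x +ᵖ (0# - τ) · d) ≡ 0# - side σ (x +ᵖ τ · d)
  side-opposite σ x τ d side≡0 = begin
    side σ (x +ᵖ (0# - τ) · d)                       ≡⟨ linear (proj₁ (Segment.p σ)) (proj₂ (Segment.p σ)) (proj₁ v) (proj₂ v) (proj₁ x) (proj₂ x) (0# - τ) (proj₁ d) (proj₂ d) ⟩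
    side σ x + (0# - τ) * cross v d                  ≡⟨ cong (_+ (0# - τ) * cross v d) side≡0 ⟩
    0# + (0# - τ) * cross v d                        ≡⟨ solve 2 (λ t c → con (ℤ.+ 0) :+ (con (ℤ.+ 0) :- t) :* c := con (ℤ.+ 0) :- (con (ℤ.+ 0) :+ t :* c)) refl τ (cross v d) ⟩
    0# - (0# + τ * cross v d)                        ≡⟨ cong (λ z → 0# - (z + τ * cross v d)) side≡0 ⟨
    0# - (side σ x + τ * cross v d)                  ≡⟨ cong (λ z → 0# - z) (linear (proj₁ (Segment.p σ)) (proj₂ (Segment.p σ)) (proj₁ v) (proj₂ v) (proj₁ x) (proj₂ x) τ (proj₁ d) (proj₂ d)) ⟨
    0# - side σ (x +ᵖ τ · d)                         ∎
    where
    open ≡-Reasoning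
    v = Segment.q σ -ᵖ Segment.p σ
    linear : ∀ p₁ p₂ v₁ v₂ x₁ x₂ t d₁ d₂ → v₁ * (x₂ + t * d₂ - p₂) - v₂ * (x₁ + t * d₁ - p₁) ≡
             v₁ * (x₂ - p₂) - v₂ * (x₁ - p₁) + t * (v₁ * d₂ - v₂ * d₁)
    linear = solve 9 (λ p₁ p₂ v₁ v₂ x₁ x₂ t d₁ d₂ → v₁ :* (x₂ :+ t :* d₂ :- p₂) :- v₂ :* (x₁ :+ t :* d₁ :- p₁) :=
             v₁ :* (x₂ :- p₂) :- v₂ :* (x₁ :- p₁) :+ t :* (v₁ :* d₂ :- v₂ :* d₁)) refl

  -- Of the points `x ± θ d` one lies on each side of the face. An affine `f` equal to `φ` near `x`
  -- would therefore have the derivative of both pieces along every `d`, forcing `u₁ ≡ u₂`.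
  separates⇒singular : ∀ {φ σ u₁ u₂ x} → Separates φ σ u₁ u₂ → RelInt σ x → ¬ Near x (AffineOn φ)
  separates⇒singular {φ} {σ} {u₁} {u₂} {x} sep x∈σ (ε , 0<ε , f , φ≗f) =
    let ε′ , 0<ε′ , sides = two-sided x x∈σ
        η , 0<η , η≤ε , η≤ε′ = smaller 0<ε 0<ε′ in
    u₁≢u₂ (⟨⟩-injective (directional η 0<η
      (λ y y∈B → φ≗f y (ball-mono {x} (<⇒≤ 0<η) η≤ε {y} y∈B))
      (λ y y∈B → sides y (ball-mono {x} (<⇒≤ 0<η) η≤ε′ {y} y∈B))))
    where
    open Separates sep
    a₁ a₂ : Affine
    a₁ = affine u₁ c₁
    a₂ = affine u₂ c₂

    side≡0 : side σ x ≡ 0#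
    side≡0 = let t , _ , _ , x≡ = x∈σ in trans (cong (side σ) x≡) (side-at σ t)

    directional : ∀ η → 0# < η → (∀ y → Ball x η y → φ y ≡ eval f y) →
      (∀ y → Ball x η y → (0# ≤ side σ y → φ y ≡ eval a₁ y) × (side σ y ≤ 0# → φ y ≡ eval a₂ y)) →
      ∀ d → ⟨ u₁ , d ⟩ ≡ ⟨ u₂ , d ⟩
    directional η 0<η φ≗f sides d =
      let θ , 0<θ , ray = ball-ray {x} d 0<η
          y  = x +ᵖ θ · d
          y′ = x +ᵖ (0# - θ) · d
          y∈B  = ray θ ≤-refl
          y′∈B = ray (0# - θ) (≤-reflexive (neg-square θ))
          opposite = side-opposite σ x θ d side≡0
          x∈B  = ball-center {x} 0<η
          at₁ = trans (sym (proj₁ (sides x x∈B) (≤-reflexive (sym side≡0)))) (φ≗f x x∈B)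
          at₂ = trans (sym (proj₂ (sides x x∈B) (≤-reflexive side≡0))) (φ≗f x x∈B)
          θ≢0 = pos⇒≢0 0<θ
          -θ≢0 = λ -θ≡0 → pos⇒≢0 0<θ (sym (x-y≡0⇒x≡y -θ≡0)) in
      compare θ θ≢0 -θ≢0 at₁ at₂ (φ≗f y y∈B) (φ≗f y′ y′∈B) (sides y y∈B) (sides y′ y′∈B) opposite (≤-total 0# (side σ y))
      where
      compare : ∀ θ → θ ≢ 0# → 0# - θ ≢ 0# → eval a₁ x ≡ eval f x → eval a₂ x ≡ eval f x →
        let y = x +ᵖ θ · d ; y′ = x +ᵖ (0# - θ) · d in
        φ y ≡ eval f y → φ y′ ≡ eval f y′ →
        (0# ≤ side σ y → φ y ≡ eval a₁ y) × (side σ y ≤ 0# → φ y ≡ eval a₂ y) →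
        (0# ≤ side σ y′ → φ y′ ≡ eval a₁ y′) × (side σ y′ ≤ 0# → φ y′ ≡ eval a₂ y′) →
        side σ y′ ≡ 0# - side σ y → 0# ≤ side σ y ⊎ side σ y ≤ 0# → ⟨ u₁ , d ⟩ ≡ ⟨ u₂ , d ⟩
      compare θ θ≢0 -θ≢0 at₁ at₂ y≗f y′≗f (φ≗₁ , _) (_ , φ≗₂) opposite (inj₁ 0≤side) = trans
        (same-directional a₁ f x θ d θ≢0 at₁ (trans (sym (φ≗₁ 0≤side)) y≗f))
        (sym (same-directional a₂ f x (0# - θ) d -θ≢0 at₂ (trans (sym (φ≗₂ (subst (_≤ 0#) (sym opposite)
          (by-nonNeg 0≤side (solve 1 (λ z → z := con (ℤ.+ 0) :- (con (ℤ.+ 0) :- z)) refl (side σ (x +ᵖ θ · d))))))) y′≗f)))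
      compare θ θ≢0 -θ≢0 at₁ at₂ y≗f y′≗f (_ , φ≗₂) (φ≗₁ , _) opposite (inj₂ side≤0) = trans
        (same-directional a₁ f x (0# - θ) d -θ≢0 at₁ (trans (sym (φ≗₁ (subst (0# ≤_) (sym opposite) (≤⇒0≤ side≤0)))) y′≗f))
        (sym (same-directional a₂ f x θ d θ≢0 at₂ (trans (sym (φ≗₂ side≤0)) y≗f)))

  -- Points in the relative interior of a convex face are themselves convex and singular, so they
  -- serve in every ball of the closure; a concave face has weight at most zero.
  face⊆support : ∀ {φ σ w} → HasWeight (𝒱₊ φ) σ w → RelInt σ ⊆ Support (𝒱₊ φ)
  face⊆support (convex sep _ conv , _) {x} x∈σ ε 0<ε =
    x , (conv x x∈σ , separates⇒singular sep x∈σ) , ball-center {x} 0<ε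
  face⊆support (concave {w = w} _ (0≤w , _) _ , 0<-w) = contradiction
    (by-nonNeg 0≤w (solve 1 (λ w → w := con (ℤ.+ 0) :- (:- w)) refl w)) (<⇒≱ 0<-w)

  support-sum : ∀ gs {x} → Support (⨁ (map hypersurface gs)) x → ∃ λ g → g ∈ gs × Support (hypersurface g) x
  support-sum (g ∷ gs) (inj₁ x∈g) = g , here refl , x∈g
  support-sum (g ∷ gs) {x} (inj₂ x∈gs) = let h , h∈gs , x∈h = support-sum gs {x} x∈gs in h , there h∈gs , x∈h

  -- The numbers 1/2, 1/4, 1/8 and so on, which give infinitely many points inside a segment.
  parameter : ℕ → ℝ
  parameter ℕ.zero  = ½
  parameter (suc n) = mid 0# (parameter n)

  parameter>0 : ∀ n → 0# < parameter n
  parameter>0 ℕ.zero  = 0<½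
  parameter>0 (suc n) = x<mid (parameter>0 n)

  parameter-decreasing : ∀ {i j} → i ℕ.< j → parameter j < parameter i
  parameter-decreasing {i} {suc j} (ℕ.s≤s i≤j) with ℕ.m≤n⇒m<n∨m≡n i≤j
  ... | inj₁ i<j  = <-trans (mid<y (parameter>0 j)) (parameter-decreasing i<j)
  ... | inj₂ refl = mid<y (parameter>0 j)

  parameter<1 : ∀ n → parameter n < 1#
  parameter<1 ℕ.zero    = subst (½ <_) ½+½ (by-pos 0<½ (solve 1 (λ h → h := h :+ h :- h) refl ½))
  parameter<1 n@(suc _) = <-trans (parameter-decreasing {0} {n} (ℕ.s≤s ℕ.z≤n)) (parameter<1 0)

  at-injective : ∀ σ {s t} → Segment.at σ s ≡ Segment.at σ t → s ≡ t
  at-injective σ {s} {t} same = x-y≡0⇒x≡y (nonzero-cancel (difference≢0 (Segment.p≢q σ))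
    (coordinate (proj₁ (Segment.p σ)) (proj₁ (Segment.q σ)) (cong proj₁ same))
    (coordinate (proj₂ (Segment.p σ)) (proj₂ (Segment.q σ)) (cong proj₂ same)))
    where
    coordinate : ∀ p q → p + s * (q - p) ≡ p + t * (q - p) → (q - p) * (s - t) ≡ 0#
    coordinate p q same = trans (solve 4 (λ p q s t → (q :- p) :* (s :- t) := p :+ s :* (q :- p) :- (p :+ t :* (q :- p))) refl p q s t)
      (x≡y⇒x-y≡0 same)

  -- Infinitely many points of σ lie on finitely many sets {ℓ = ℓ′}, so two of
  -- them lie on the same one.
  edge-on-face : ∀ gs σ L → SpannedBy L σ → (∀ x → RelInt σ x → Support (⨁ (map hypersurface gs)) x) →
                 Any (λ g → HasEdgeOn g L) gs
  edge-on-face gs σ L (_ , hull⊆L) singular =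
    let i , j , i<j , (g , ℓ , ℓ′) , (g∈gs , ℓ≢ℓ′ , ess , ess′ , act-i , act′-i) , (_ , _ , _ , _ , act-j , act′-j) =
          repeated-value candidates Witness witnesses in
    lose g∈gs (record
      { ℓ = ℓ ; ℓ′ = ℓ′ ; p = point i ; q = point j ; ℓ≢ℓ′ = ℓ≢ℓ′ ; ess = ess ; ess′ = ess′
      ; p≢q = λ same → proj₂ (parameter-decreasing i<j) (sym (at-injective σ same))
      ; p∈L = hull⊆L (parameter i , refl) ; q∈L = hull⊆L (parameter j , refl)
      ; active-p = act-i ; active-q = act-j ; active′-p = act′-i ; active′-q = act′-j })
    where
    point : ℕ → Point
    point n = Segment.at σ (parameter n)

    terms : List Affine
    terms = concatMap toList gs

    candidates : List (TropicalPolynomial × Affine × Affine)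
    candidates = cartesianProduct gs (cartesianProduct terms terms)

    Witness : ℕ → TropicalPolynomial × Affine × Affine → Set
    Witness n (g , ℓ , ℓ′) = g ∈ gs × ℓ ≢ ℓ′ × Essential g ℓ × Essential g ℓ′ × Active g ℓ (point n) × Active g ℓ′ (point n)

    witnesses : ∀ n → Any (Witness n) candidates
    witnesses n =
      let g , g∈gs , x∈g = support-sum gs {point n} (singular (point n) (parameter n , parameter>0 n , parameter<1 n , refl))
          δ , generic = generic-exists g
          ℓ , ℓ′ , ℓ≢ℓ′ , ess , ess′ , act , act′ = two-essentials {g} {δ , 1#} generic (point n) x∈g in
      lose (∈-cartesianProduct⁺ g∈gs (∈-cartesianProduct⁺
              (∈-concatMap⁺ toList (lose g∈gs (Active.term act))) (∈-concatMap⁺ toList (lose g∈gs (Active.term act′)))))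
        (g∈gs , ℓ≢ℓ′ , ess , ess′ , act , act′)

  Distinct : List WeightedLine → Set
  Distinct = AllPairs (λ L M → ¬ (Line L ≐ Line M))

  -- A line that carries edges of several summands is counted at the first of them only: the lines
  -- of `g` are filtered out before the recursive call.
  edges-bound : ∀ gs {ms Ls} → Pointwise MComp (map hypersurface gs) ms → Distinct Ls →
                All (λ L → Any (λ g → HasEdgeOn g L) gs) Ls → length Ls ℕ.+ 3 ℕ.* length gs ℕ.≤ 3 ℕ.* sum ms
  edges-bound []       {Ls = []}    []  _ _ = ℕ.z≤n
  edges-bound []       {Ls = _ ∷ _} []  _ (() ∷ _)
  edges-bound (g ∷ gs) {m ∷ ms} {Ls} (components ∷ rest) distinct edges =
    subst (λ n → n ℕ.+ 3 ℕ.* suc (length gs) ℕ.≤ 3 ℕ.* (m ℕ.+ sum ms)) (sym (length-split on-g? Ls)) (add-bounds {length Ls₁} {length Ls₂} {length gs} {m} first others)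
    where
    on-g? : Decidable (HasEdgeOn g)
    on-g? L = em
    Ls₁ = filter on-g? Ls
    Ls₂ = filter (∁? on-g?) Ls
    first : length Ls₁ ℕ.+ 3 ℕ.≤ 3 ℕ.* m
    first = lines-bound g components (AllPairs.filter⁺ on-g? distinct) (All.all-filter on-g? Ls)
    elsewhere : ∀ {L} → Any (λ g → HasEdgeOn g L) (g ∷ gs) × ¬ HasEdgeOn g L → Any (λ g → HasEdgeOn g L) gs
    elsewhere (here on , off) = contradiction on off
    elsewhere (there on , _)  = on
    others : length Ls₂ ℕ.+ 3 ℕ.* length gs ℕ.≤ 3 ℕ.* sum ms
    others = edges-bound gs rest (AllPairs.filter⁺ (∁? on-g?) distinct)
      (All.map elsewhere (All.zip (All.filter⁺ (∁? on-g?) edges , All.all-filter (∁? on-g?) Ls)))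

  line-components-bound : ∀ Ls {ms} → Pointwise MComp (map lineComplex Ls) ms → sum ms ℕ.≤ 2 ℕ.* length Ls
  line-components-bound []       []                  = ℕ.z≤n
  line-components-bound (L ∷ Ls) {m ∷ ms} (components ∷ rest) = subst (m ℕ.+ sum ms ℕ.≤_) (sym (ℕ.*-suc 2 (length Ls)))
    (ℕ.+-mono-≤ (line-components {L} components) (line-components-bound Ls rest))

  arrangement-inequality : (φ : Point → ℝ) (gs : List TropicalPolynomial) (c : ℤ) → IsMinimalBalancing (𝒱₊ φ) gs c →
    (Ls : List WeightedLine) → IsAssociatedArrangement (𝒱₊ φ) Ls → (a : ℤ) → FComp (map lineComplex Ls) a →
    a ℤ.≤ + 3 ℤ.* c
  arrangement-inequality φ gs c balancing Ls arrangement a (ls , line-comps , a≡) =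
    let ms , comps , c≡ = fComp in
    subst₂ (λ a c → a ℤ.≤ + 3 ℤ.* c)
      (sym (trans a≡ (cong (λ n → (+ sum ls) ℤ.- ((+ n) ℤ.- ℤ.1ℤ)) (length-map lineComplex Ls))))
      (sym (trans c≡ (cong (λ n → (+ sum ms) ℤ.- ((+ n) ℤ.- ℤ.1ℤ)) (length-map hypersurface gs))))
      (arrangement-bound {length Ls} {length gs} (line-components-bound Ls line-comps)
        (edges-bound gs comps distinct (All.map (λ {L} → edge-on L) spanned)))
    where
    open IsMinimalBalancing balancing
    open IsAssociatedArrangement arrangement

    edge-on : ∀ L → (∃ λ σ → HasWeight (𝒱₊ φ) σ (weight L) × SpannedBy L σ) → Any (λ g → HasEdgeOn g L) gs
    -- The spanning face lies in the support of the complex, hence in that of the balancing, so each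
    -- point inside it is singular for some summand.
    edge-on L (σ , face , span) = edge-on-face gs σ L span λ x x∈σ →
      Balances.subcomplex balances (face⊆support {φ} {σ} face {x} x∈σ)

open import Data.Integer.Base using (_*_; _≤_)

proposition4 : (∀ {ℓ} → ExcludedMiddle ℓ) →
    (R : CompleteOrderedField) → let open TropicalPlane R in
    (φ : Point → CompleteOrderedField.ℝ R) → PiecewiseLinear φ →
    (gs : List TropicalPolynomial) (c : ℤ) → IsMinimalBalancing (𝒱₊ φ) gs c →
    (Ls : List WeightedLine) → IsAssociatedArrangement (𝒱₊ φ) Ls →
    (a : ℤ) → FComp (map lineComplex Ls) a →
    a ≤ + 3 * c
proposition4 em R φ _ = Faces.arrangement-inequality em R φ
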